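{- Let $\mathcal{H}=(V,\mathcal{E})$ be a Steiner system. The following are equivalent: (i) the Boolean function $f_{\mathcal{H}}$ is irreducible; (ii) $\mathcal{H}_{e}\cong \mathcal{H}_{e'}$ for every $e,e'\in [V]^2$; (iii) $\mathcal{H}$ is $-2$-monomorphic.
   Context: A hypergraph is a pair $\mathcal{H}=(V,\mathcal{E})$ with $V$ a finite nonempty set (vertices) and $\mathcal{E}$ a set of subsets of $V$ (hyperedges; the empty set is allowed as a hyperedge). $[V]^m$ denotes the set of $m$-element subsets of $V$. Two hypergraphs $(V,\mathcal{E})$, $(V',\mathcal{E}')$ are isomorphic ($\cong$) if there is a bijection $\varphi:V\to V'$ such that for all $E\subseteq V$, $E\in\mathcal{E}$ iff $\varphi(E)\in\mathcal{E}'$. Steiner system: $\mathcal{H}=(V,\mathcal{E})$ is a Steiner system if for some $k$ one has $\mathcal{E}\subseteq [V]^k$ and every $e\in[V]^2$ is contained in exactly one $E\in\mathcal{E}$ (i.e. it is a $2$-$(n,k,1)$ design, $n=|V|$). The hypergraph $\mathcal{H}_e$: for $e=\{i,j\}\in[V]^2$ and a new vertex $l_e\notin V$, $\mathcal{H}_e=(V_e,\mathcal{E}_e)$ where $V_e=(V\setminus e)\cup\{l_e\}$ and a set $E\subseteq V_e$ belongs to $\mathcal{E}_e$ iff either $l_e\notin E$ and $E\in\mathcal{E}$, or $l_e\in E$ and exactly one or all three of the sets $(E\setminus\{l_e\})\cup\{i\}$, $(E\setminus\{l_e\})\cup\{j\}$, $(E\setminus\{l_e\})\cup\{i,j\}$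 belong to $\mathcal{E}$. $-2$-monomorphic: for $e\in[V]^2$ let $\mathcal{H}_{\setminus e}=(V\setminus e,\{E\in\mathcal{E}:E\cap e=\emptyset\})$ be the induced hypergraph obtained by deleting the two vertices of $e$. $\mathcal{H}$ is $-2$-monomorphic if $\mathcal{H}_{\setminus e}\cong\mathcal{H}_{\setminus e'}$ for all $e,e'\in[V]^2$. Boolean functions: a Boolean function is a map $f:\{0,1\}^n\to\{0,1\}$, $n\ge1$; $\Omega$ is the set of all of them. For $g$ of arity $m$ and $f$ of arity $n$, $g\le f$ ($g$ is a simple minor of $f$) if there is $\sigma:\{1,\dots,n\}\to\{1,\dots,m\}$ with $g(x_1,\dots,x_m)=f(x_{\sigma(1)},\dots,x_{\sigma(n)})$; $g<f$ means $g\le f$ and not $f\le g$. $f$ is irreducible if there is $f'\in\Omega$ with $f'<f$ such that every $g\in\Omega$ with $g<f$ satisfies $g\le f'$. For a hypergraph $\mathcal{H}=(V,\mathcal{E})$ (with $V$ identified with $\{1,\dots,n\}$), $f_{\mathcal{H}}$ is the $n$-ary Boolean function given by evaluating over $GF(2)$ the polynomial $P_{\mathcal{H}}=\sum_{E\in\mathcal{E}}\prod_{i\in E}x_i$ (irreducibility does not depend on the identification).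
   Formalization: The one-vertex case is excluded by requiring 2 ≤ k ≤ n in the definition of a Steiner system: for |V| = 1, (ii) and (iii) hold vacuously while f_H has no strict minor, so (i) fails; for |V| ≥ 2 the requirement is automatic. -}

module Defs where

open import Data.Bool.Base using (Bool; true; false; not; _∨_; _xor_; T)
open import Data.Bool.ListAction using (and)
open import Data.Bool.Properties using (T?)
open import Data.Fin.Base using (Fin; zero; suc)
open import Data.Fin.Properties using (inj⇒≟)
open import Data.List.Base as List using (List; allFin; filterᵇ; foldr)
open import Data.Maybe.Base using (Maybe; just; nothing)
open import Data.Nat.Base using (ℕ; zero; suc; NonZero; _≤_)
open import Data.Product.Base using (Σ-syntax; ∃-syntax; _×_; _,_; proj₁)
open import Data.Product using (∃!)
open import Data.Vec.Base as Vec using (Vec; lookup; tabulate)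
open import Function.Base using (_∘_)
open import Function.Bundles using (_↔_; Inverse)
open import Function.Properties.Inverse using (↔-sym; Inverse⇒Injection)
open import Relation.Binary.Definitions using (DecidableEquality)
open import Relation.Binary.PropositionalEquality
  using (_≡_; _≗_; refl; cong)
open import Relation.Nullary using (¬_; yes; no; ⌊_⌋)

------------------------------------------------------------------------
-- Subsets

-- Vertex sets are finite, so every subset has a Boolean characteristic
-- function. Equality of subsets is _≗_.
Subset : Set → Set
Subset V = V → Bool

module _ {V : Set} where

  infix 4 _∈_ _⊆_
  infixr 6 _∪_

  _∈_ : V → Subset V → Set
  v ∈ A = T (A v)

  _⊆_ : Subset V → Subset V → Set
  A ⊆ B = ∀ {v} → v ∈ A → v ∈ B

  _∪_ : Subset V → Subset V → Subset V
  (A ∪ B) v = A v ∨ B v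

  ∁ : Subset V → Subset V
  ∁ A v = not (A v)

  -- T is proof-irrelevant, so each element is counted once.
  ⟦_⟧ : Subset V → Set
  ⟦ A ⟧ = Σ[ v ∈ V ] v ∈ A

  -- A subset of A, seen as a subset of V.
  extend : (A : Subset V) → Subset ⟦ A ⟧ → Subset V
  extend A E v with T? (A v)
  ... | yes v∈A = E (v , v∈A)
  ... | no  _   = false

  extend-cong : ∀ A {E E′ : Subset ⟦ A ⟧} → E ≗ E′ → extend A E ≗ extend A E′
  extend-cong A E≗E′ v with T? (A v)
  ... | yes v∈A = E≗E′ (v , v∈A)
  ... | no  _   = refl

  HasSize : Subset V → ℕ → Set
  HasSize A m = Fin m ↔ ⟦ A ⟧

[_]^_ : Set → ℕ → Set
[ V ]^ m = Σ[ A ∈ Subset V ] HasSize A m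

------------------------------------------------------------------------
-- Hypergraphs

-- Finiteness and nonemptiness of V are not fields: they are imposed on V
-- where needed, by an enumeration Fin n ↔ V with n nonzero.
record Hypergraph (V : Set) : Set where
  field
    hyperedge      : Subset V → Bool
    hyperedge-cong : ∀ {E E′} → E ≗ E′ → hyperedge E ≡ hyperedge E′

open Hypergraph public

infix 4 _∈ℰ_ _≅_

_∈ℰ_ : {V : Set} → Subset V → Hypergraph V → Set
E ∈ℰ H = T (hyperedge H E)

-- The image of E under a bijection φ is E ∘ φ⁻¹.
image : {V V′ : Set} → V ↔ V′ → Subset V → Subset V′
image φ E = E ∘ Inverse.from φ

_≅_ : {V V′ : Set} → Hypergraph V → Hypergraph V′ → Set
_≅_ {V} {V′} H H′ =
  Σ[ φ ∈ (V ↔ V′) ] (∀ E → hyperedge H E ≡ hyperedge H′ (image φ E))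

-- 2-(n,k,1) designs, n being the number of vertices. The usual convention
-- 2 ≤ k ≤ n on design parameters follows from the last two fields as soon
-- as n ≥ 2, so it only excludes n ≤ 1. For n = 1 there are no pairs of
-- vertices, and f_H (a constant or a projection) is never irreducible.
record IsSteinerSystem {V : Set} (n : ℕ) (H : Hypergraph V) : Set where
  field
    k       : ℕ
    2≤k     : 2 ≤ k
    k≤n     : k ≤ n
    uniform : ∀ E → E ∈ℰ H → HasSize E k
    cover   : ((e , _) : [ V ]^ 2) → ∃! _≗_ λ E → E ∈ℰ H × e ⊆ E

infixl 8 _∖_

_∖_ : {V : Set} → Hypergraph V → ((e , _) : [ V ]^ 2) → Hypergraph ⟦ ∁ e ⟧
hyperedge      (H ∖ (e , _)) E    = hyperedge H (extend (∁ e) E)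
hyperedge-cong (H ∖ (e , _)) E≗E′ = hyperedge-cong H (extend-cong (∁ e) E≗E′)

-2-Monomorphic : {V : Set} → Hypergraph V → Set
-2-Monomorphic {V} H = (e e′ : [ V ]^ 2) → H ∖ e ≅ H ∖ e′

exactlyOneOrAll : Bool → Bool → Bool → Bool
exactlyOneOrAll true  true  true  = true
exactlyOneOrAll true  false false = true
exactlyOneOrAll false true  false = true
exactlyOneOrAll false false true  = true
exactlyOneOrAll _     _     _     = false

module _ {V : Set} (_≟_ : DecidableEquality V) where

  ⁅_⁆ : V → Subset V
  ⁅ i ⁆ v = ⌊ v ≟ i ⌋

  -- H_e, on (V ∖ e) ∪ {l_e} with l_e = nothing. If E is a set of vertices of
  -- H_e then E₀ is E ∖ {l_e}, seen as a subset of V.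
  collapse : Hypergraph V → ((e , _) : [ V ]^ 2) → Hypergraph (Maybe ⟦ ∁ e ⟧)
  collapse H (e , enum) = record
    { hyperedge      = λ E → edge (E nothing) (extend (∁ e) (E ∘ just))
    ; hyperedge-cong = λ {E} {E′} E≗E′ → edge-cong
        (E≗E′ nothing) (extend-cong (∁ e) (E≗E′ ∘ just))
    }
    where
    i j : V
    i = proj₁ (Inverse.to enum zero)
    j = proj₁ (Inverse.to enum (suc zero))

    edge : Bool → Subset V → Bool
    edge false E₀ = hyperedge H E₀
    edge true  E₀ = exactlyOneOrAll
      (hyperedge H (E₀ ∪ ⁅ i ⁆))
      (hyperedge H (E₀ ∪ ⁅ j ⁆))
      (hyperedge H (E₀ ∪ ⁅ i ⁆ ∪ ⁅ j ⁆))

    ∪-congˡ : ∀ {A A′ B : Subset V} → A ≗ A′ → A ∪ B ≗ A′ ∪ B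
    ∪-congˡ {B = B} A≗A′ v = cong (_∨ B v) (A≗A′ v)

    edge-cong : ∀ {b b′ E₀ E₀′} → b ≡ b′ → E₀ ≗ E₀′ → edge b E₀ ≡ edge b′ E₀′
    edge-cong {false} refl eq = hyperedge-cong H eq
    edge-cong {true} {E₀ = E₀} {E₀′} refl eq
      rewrite hyperedge-cong H (∪-congˡ {B = ⁅ i ⁆} eq)
            | hyperedge-cong H (∪-congˡ {B = ⁅ j ⁆} eq)
            | hyperedge-cong H (∪-congˡ {B = ⁅ i ⁆ ∪ ⁅ j ⁆} eq) = refl

------------------------------------------------------------------------
-- Boolean functions

record Ω : Set where
  constructor boolFun
  field
    arity              : ℕ
    .{{arity-nonZero}} : NonZero arity
    eval               : Vec Bool arity → Bool

open Ω public

infix 4 _≼_ _≺_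

_≼_ : Ω → Ω → Set
g ≼ f = Σ[ σ ∈ (Fin (arity f) → Fin (arity g)) ]
  (∀ x → eval g x ≡ eval f (tabulate (λ i → lookup x (σ i))))

_≺_ : Ω → Ω → Set
g ≺ f = g ≼ f × ¬ (f ≼ g)

Irreducible : Ω → Set
Irreducible f = ∃[ f′ ] (f′ ≺ f × (∀ g → g ≺ f → g ≼ f′))

subsets : ∀ n → List (Vec Bool n)
subsets zero    = Vec.[] List.∷ List.[]
subsets (suc n) = List.map (false Vec.∷_) (subsets n)
           List.++ List.map (true Vec.∷_) (subsets n)

-- The product over i ∈ E of x_i, with GF(2) = (Bool, _xor_, _∧_).
monomial : ∀ {n} → Vec Bool n → Vec Bool n → Bool
monomial {n} E x = and (List.map (lookup x) (filterᵇ (lookup E) (allFin n)))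

module _ {n : ℕ} {V : Set} (enum : Fin n ↔ V) where

  enum⇒≟ : DecidableEquality V
  enum⇒≟ = inj⇒≟ (Inverse⇒Injection (↔-sym enum))

  -- f_H, with the i-th vertex of the enumeration identified with i.
  polynomial : Hypergraph V → Vec Bool n → Bool
  polynomial H x = foldr _xor_ false
    (List.map (λ E → monomial E x)
      (filterᵇ (λ E → hyperedge H (image enum (lookup E))) (subsets n)))

  booleanFunction : .{{NonZero n}} → Hypergraph V → Ω
  booleanFunction H = boolFun n (polynomial H)

{-# OPTIONS --safe #-}

-- Let f = f_H. By uniqueness of the algebraic normal form, f depends on all its variables,
-- so the functions below f are those below some f_{H_e}, the minor identifying the two
-- variables in e. Hence f is irreducible iff some f_{H_e₀} is above all others. If all blocks
-- have at least 3 points, then every f_{H_e} depends on all its n − 1 variables, and therefore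
-- f_{H_e} ≤ f_{H_e₀} forces H_e ≅ H_e₀.
--
-- For blocks of size at least 3, the edges of H_e are exactly the images of the blocks under
-- the identification of the two points of e, so any two vertices other than l_e lie on at most
-- one edge. A vertex w off the line through e shares two edges with l_e, hence an isomorphism
-- H_e ≅ H_e′ maps l_e to l_e′ and restricts to V ∖ e. Conversely, an isomorphism of V ∖ e onto
-- V ∖ e′ extends because the traces of the blocks meeting e are recognised by the pairs of
-- points not joined by a block avoiding e.
--
-- If the blocks have size 2, then H is a complete graph and all permutations are automorphisms.

module Submission where

open import Data.Bool.Base using (Bool; true; false; not; _∧_; _∨_; _xor_; T)
import Data.Bool.Properties as Bool
open import Data.Bool.Solver using (module xor-∧-Solver)
open import Data.Empty using (⊥-elim)
open import Data.Fin.Base using (Fin; zero; suc; punchOut)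
import Data.Fin.Permutation as Perm
import Data.Fin.Permutation.Components as PC
import Data.Fin.Properties as Fin
open import Data.List.Base as List using (List; allFin; filterᵇ; foldr)
open import Data.List.Properties using (map-tabulate)
open import Data.Maybe.Base as Maybe using (Maybe; just; nothing)
open import Data.Maybe.Properties using (just-injective)
open import Data.Nat.Base using (ℕ; zero; suc; _≤_; s≤s; NonZero)
import Data.Nat.Properties as ℕ
open import Data.Product.Base using (Σ-syntax; ∃-syntax; _×_; _,_; proj₁; proj₂)
open import Data.Sum.Base using (_⊎_; inj₁; inj₂; [_,_]′)
open import Data.Vec.Base using (Vec; []; _∷_; lookup; tabulate; _[_]≔_)
open import Data.Vec.Properties
  using (≡-dec; lookup∘tabulate; tabulate∘lookup; tabulate-cong; lookup∘update′)
open import Function.Base using (_∘_; id)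
open import Function.Bundles using (_↔_; Inverse; mk↔ₛ′; Equivalence; _⇔_; mk⇔)
open import Function.Definitions using (Injective)
open import Function.Properties.Inverse using (↔-sym; ↔-trans; ↔-refl)
open import Relation.Binary.Definitions using (DecidableEquality)
open import Relation.Binary.PropositionalEquality
open import Relation.Nullary using (¬_; Dec; does; yes; no)
open import Relation.Nullary.Decidable
  using (map′; _×-dec_; _⊎-dec_; ¬?; dec-true; dec-false; fromWitness; toWitness)
open import Relation.Nullary.Negation using (contradiction)
open import Defs

open Inverse
open Equivalence using () renaming (to to ⇒; from to ⇐)
open xor-∧-Solver using (solve; _:+_; _:*_; _:=_)
open ≡-Reasoning

private variable
  m n n′ : ℕ
  S R V V′ : Set

-- Algebraic normal forms

T-ext : ∀ {a b} → (T a → T b) → (T b → T a) → a ≡ b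
T-ext {true}  {true}  _ _ = refl
T-ext {true}  {false} f _ = ⊥-elim (f _)
T-ext {false} {true}  _ g = ⊥-elim (g _)
T-ext {false} {false} _ _ = refl

Coefficients : ℕ → Set
Coefficients n = Vec Bool n → Bool

-- The polynomial with coefficients c takes the value ⨁_{E ⊆ x} c(E) at x.
ζ : Coefficients n → Vec Bool n → Bool
ζ c []      = c []
ζ c (b ∷ x) = ζ (c ∘ (false ∷_)) x xor (b ∧ ζ (c ∘ (true ∷_)) x)

ζ-cong : {c d : Coefficients n} → c ≗ d → ζ c ≗ ζ d
ζ-cong c≗d []      = c≗d []
ζ-cong c≗d (b ∷ x) = cong₂ (λ u v → u xor (b ∧ v))
  (ζ-cong (c≗d ∘ (false ∷_)) x) (ζ-cong (c≗d ∘ (true ∷_)) x)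

xor-cancelˡ : ∀ a {b c} → a xor b ≡ a xor c → b ≡ c
xor-cancelˡ false eq = eq
xor-cancelˡ true {false} {false} eq = refl
xor-cancelˡ true {true}  {true}  eq = refl

-- Uniqueness of the algebraic normal form. At first coordinate 0 only the monomials without the
-- first variable contribute, which settles their coefficients; at 1 their contribution cancels and
-- the others remain.
ζ-injective : {c d : Coefficients n} → ζ c ≗ ζ d → c ≗ d
ζ-injective eq []          = eq []
ζ-injective {c = c} {d} eq (b ∷ E) = at b E
  where
  at₀ : ζ (c ∘ (false ∷_)) ≗ ζ (d ∘ (false ∷_))
  at₀ x = trans (sym (Bool.xor-identityʳ _)) (trans (eq (false ∷ x)) (Bool.xor-identityʳ _))

  at : ∀ b → c ∘ (b ∷_) ≗ d ∘ (b ∷_)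
  at false = ζ-injective at₀
  at true  = ζ-injective λ x → xor-cancelˡ (ζ (c ∘ (false ∷_)) x)
    (trans (eq (true ∷ x)) (cong (_xor _) (sym (at₀ x))))

ζ-xor : (c d : Coefficients n) → ζ (λ E → c E xor d E) ≗ (λ x → ζ c x xor ζ d x)
ζ-xor c d []      = refl
ζ-xor c d (b ∷ x) = begin
  _
    ≡⟨ cong₂ (λ u v → u xor (b ∧ v)) (ζ-xor (c ∘ (false ∷_)) (d ∘ (false ∷_)) x)
                                     (ζ-xor (c ∘ (true ∷_)) (d ∘ (true ∷_)) x) ⟩
  (c₀ xor d₀) xor (b ∧ (c₁ xor d₁))
    ≡⟨ solve 5 (λ b c₀ c₁ d₀ d₁ → (c₀ :+ d₀) :+ (b :* (c₁ :+ d₁)) :=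
         (c₀ :+ (b :* c₁)) :+ (d₀ :+ (b :* d₁))) refl b c₀ c₁ d₀ d₁ ⟩
  (c₀ xor (b ∧ c₁)) xor (d₀ xor (b ∧ d₁)) ∎
  where
  c₀ = ζ (c ∘ (false ∷_)) x
  c₁ = ζ (c ∘ (true ∷_)) x
  d₀ = ζ (d ∘ (false ∷_)) x
  d₁ = ζ (d ∘ (true ∷_)) x

ζ-zero : (x : Vec Bool n) → ζ (λ _ → false) x ≡ false
ζ-zero []      = refl
ζ-zero (b ∷ x) = cong₂ (λ u v → u xor v) (ζ-zero x)
  (trans (cong (b ∧_) (ζ-zero x)) (Bool.∧-zeroʳ b))

-- The value of the monomial of `E` at `x`; read as a relation, `E` is a subset of `x`.
contains : Vec Bool n → Vec Bool n → Bool
contains []      []      = true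
contains (b ∷ x) (e ∷ E) = (not e ∨ b) ∧ contains x E

contains⁺ : (x E : Vec Bool n) → (∀ i → T (lookup E i) → T (lookup x i)) → T (contains x E)
contains⁺ []      []          _ = _
contains⁺ (b ∷ x) (false ∷ E) h = contains⁺ x E (h ∘ suc)
contains⁺ (true ∷ x)  (true ∷ E) h = contains⁺ x E (h ∘ suc)
contains⁺ (false ∷ x) (true ∷ E) h = ⊥-elim (h zero _)

contains⁻ : (x E : Vec Bool n) → T (contains x E) → ∀ i → T (lookup E i) → T (lookup x i)
contains⁻ (true ∷ x)  (true ∷ E)  h zero    _   = _
contains⁻ (true ∷ x)  (true ∷ E)  h (suc i) i∈E = contains⁻ x E h i i∈E
contains⁻ (b ∷ x)     (false ∷ E) h (suc i) i∈E = contains⁻ x E h i i∈E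

tabulate-suc : ∀ n → List.tabulate {n = n} (λ i → Fin.suc i) ≡ List.map Fin.suc (allFin n)
tabulate-suc n = sym (map-tabulate id Fin.suc)

filterᵇ-map : (p : R → Bool) (f : S → R) (l : List S) →
  filterᵇ p (List.map f l) ≡ List.map f (filterᵇ (p ∘ f) l)
filterᵇ-map p f List.[]      = refl
filterᵇ-map p f (a List.∷ l) with p (f a)
... | true  = cong (f a List.∷_) (filterᵇ-map p f l)
... | false = filterᵇ-map p f l

monomial-contains : (E x : Vec Bool n) → monomial E x ≡ contains x E
monomial-contains []      []      = refl
monomial-contains {suc n} (e ∷ E) (b ∷ x) = trans (head e) (cong ((not e ∨ b) ∧_) rest)
  where
  tail : Bool
  tail = foldr _∧_ true (List.map (lookup (b ∷ x)) (filterᵇ (lookup (e ∷ E)) (List.tabulate Fin.suc)))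

  map-map : (l : List (Fin n)) → List.map (lookup (b ∷ x)) (List.map suc l) ≡ List.map (lookup x) l
  map-map List.[]      = refl
  map-map (i List.∷ l) = cong (lookup x i List.∷_) (map-map l)

  rest : tail ≡ contains x E
  rest = begin
    tail
      ≡⟨ cong (λ l → foldr _∧_ true (List.map (lookup (b ∷ x)) (filterᵇ (lookup (e ∷ E)) l)))
           (tabulate-suc n) ⟩
    _ ≡⟨ cong (foldr _∧_ true ∘ List.map (lookup (b ∷ x))) (filterᵇ-map (lookup (e ∷ E)) suc (allFin n)) ⟩
    _ ≡⟨ cong (foldr _∧_ true) (map-map (filterᵇ (lookup E) (allFin n))) ⟩
    monomial E x
      ≡⟨ monomial-contains E x ⟩
    contains x E ∎

  head : ∀ e → foldr _∧_ true (List.map (lookup (b ∷ x)) (filterᵇ (lookup (e ∷ E)) (allFin (suc n))))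
             ≡ (not e ∨ b) ∧
               foldr _∧_ true (List.map (lookup (b ∷ x)) (filterᵇ (lookup (e ∷ E)) (List.tabulate Fin.suc)))
  head true  = refl
  head false = refl

-- `polynomial` unfolds to this sum, with the coefficients as `c` and the monomials as `w`.
⨁ : (S → Bool) → (S → Bool) → List S → Bool
⨁ c w l = foldr _xor_ false (List.map w (filterᵇ c l))

⨁-++ : (c w : S → Bool) (k l : List S) → ⨁ c w (k List.++ l) ≡ ⨁ c w k xor ⨁ c w l
⨁-++ c w List.[]      l = refl
⨁-++ c w (a List.∷ k) l with c a
... | true  = trans (cong (w a xor_) (⨁-++ c w k l)) (sym (Bool.xor-assoc (w a) _ _))
... | false = ⨁-++ c w k l

⨁-map : (c w : R → Bool) (f : S → R) (l : List S) → ⨁ c w (List.map f l) ≡ ⨁ (c ∘ f) (w ∘ f) l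
⨁-map c w f List.[]      = refl
⨁-map c w f (a List.∷ l) with c (f a)
... | true  = cong (w (f a) xor_) (⨁-map c w f l)
... | false = ⨁-map c w f l

-- Distributivity. It factors out the leading variable, and with `b = true` it replaces the weights
-- pointwise.
⨁-scale : (c : S → Bool) {w w′ : S → Bool} (b : Bool) → (∀ a → w a ≡ b ∧ w′ a) →
  ∀ l → ⨁ c w l ≡ b ∧ ⨁ c w′ l
⨁-scale c b eq List.[]      = sym (Bool.∧-zeroʳ b)
⨁-scale c {w′ = w′} b eq (a List.∷ l) with c a
... | true  = trans (cong₂ _xor_ (eq a) (⨁-scale c b eq l))
                (solve 3 (λ b u v → (b :* u) :+ (b :* v) := b :* (u :+ v)) refl b (w′ a) _)
... | false = ⨁-scale c b eq l

⨁-subsets : (c : Coefficients n) (x : Vec Bool n) → ⨁ c (contains x) (subsets n) ≡ ζ c x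
⨁-subsets {zero} c [] with c []
... | true  = refl
... | false = refl
⨁-subsets {suc n} c (b ∷ x) = begin
  ⨁ c (contains (b ∷ x)) (subsets (suc n))
    ≡⟨ ⨁-++ c _ (List.map (false ∷_) (subsets n)) _ ⟩
  ⨁ c (contains (b ∷ x)) (List.map (false ∷_) (subsets n)) xor
  ⨁ c (contains (b ∷ x)) (List.map (true ∷_) (subsets n))
    ≡⟨ cong₂ _xor_ (⨁-map c _ (false ∷_) (subsets n)) (⨁-map c _ (true ∷_) (subsets n)) ⟩
  ⨁ (c ∘ (false ∷_)) (contains x) (subsets n) xor
  ⨁ (c ∘ (true ∷_)) (λ E → b ∧ contains x E) (subsets n)
    ≡⟨ cong₂ _xor_ (⨁-subsets _ x)
         (trans (⨁-scale _ b (λ _ → refl) (subsets n)) (cong (b ∧_) (⨁-subsets _ x))) ⟩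
  ζ c (b ∷ x) ∎

coefficients : {V : Set} → Fin n ↔ V → Hypergraph V → Coefficients n
coefficients enum H E = hyperedge H (image enum (lookup E))

polynomial-ζ : {V : Set} (enum : Fin n ↔ V) (H : Hypergraph V) →
  polynomial enum H ≗ ζ (coefficients enum H)
polynomial-ζ {n} enum H x = trans (⨁-cong (subsets n)) (⨁-subsets _ x)
  where
  c = coefficients enum H
  ⨁-cong : ∀ l → ⨁ c (λ E → monomial E x) l ≡ ⨁ c (contains x) l
  ⨁-cong = ⨁-scale c true (λ E → monomial-contains E x)

-- The coefficients of the single monomial `G`.
δ : Vec Bool n → Coefficients n
δ G E = does (≡-dec Bool._≟_ G E)

δ-sound : (G E : Vec Bool n) → T (δ G E) → G ≡ E
δ-sound G E h with ≡-dec Bool._≟_ G E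
... | yes G≡E = G≡E

δ-complete : (G E : Vec Bool n) → G ≡ E → T (δ G E)
δ-complete G E G≡E with ≡-dec Bool._≟_ G E
... | yes _   = _
... | no G≢E = G≢E G≡E

ζ-δ : (G x : Vec Bool n) → ζ (δ G) x ≡ contains x G
ζ-δ []          []      = refl
ζ-δ (false ∷ G) (b ∷ x) = begin
  ζ (δ G) x xor (b ∧ ζ (λ _ → false) x)
    ≡⟨ cong (λ u → ζ (δ G) x xor (b ∧ u)) (ζ-zero x) ⟩
  ζ (δ G) x xor (b ∧ false)
    ≡⟨ cong (ζ (δ G) x xor_) (Bool.∧-zeroʳ b) ⟩
  ζ (δ G) x xor false
    ≡⟨ Bool.xor-identityʳ _ ⟩
  ζ (δ G) x
    ≡⟨ ζ-δ G x ⟩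
  contains x G ∎
ζ-δ (true ∷ G) (b ∷ x) = cong₂ (λ u v → u xor (b ∧ v)) (ζ-zero x) (ζ-δ G x)

-- The scalars are 0 and 1, so additivity is all of linearity over GF(2); `respects` takes the place
-- of function extensionality.
record Linear (L : Coefficients n → Bool) : Set where
  field
    respects : ∀ {c d} → c ≗ d → L c ≡ L d
    additive : ∀ c d → L (λ E → c E xor d E) ≡ L c xor L d

open Linear

Linear-zero : {L : Coefficients n → Bool} → Linear L → L (λ _ → false) ≡ false
Linear-zero {L = L} lin = trans (additive lin (λ _ → false) (λ _ → false)) (Bool.xor-same (L _))

prepend : Bool → Coefficients n → Coefficients (suc n)
prepend b c (b′ ∷ E) = does (b Bool.≟ b′) ∧ c E

prepend-decompose : (c : Coefficients (suc n)) →
  c ≗ λ E → prepend false (c ∘ (false ∷_)) E xor prepend true (c ∘ (true ∷_)) E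
prepend-decompose c (false ∷ E) = sym (Bool.xor-identityʳ _)
prepend-decompose c (true ∷ E)  = refl

Linear-prepend : {L : Coefficients (suc n) → Bool} → Linear L → ∀ b → Linear (L ∘ prepend b)
Linear-prepend lin b .respects c≗d =
  respects lin λ { (b′ ∷ E) → cong (does (b Bool.≟ b′) ∧_) (c≗d E) }
Linear-prepend lin b .additive c d = trans
  (respects lin λ { (b′ ∷ E) → Bool.∧-distribˡ-xor (does (b Bool.≟ b′)) (c E) (d E) })
  (additive lin (prepend b c) (prepend b d))

-- Reduces an identity that is linear in the coefficients to the case of a single monomial.
Linear-ext : {L M : Coefficients n → Bool} → Linear L → Linear M →
  (∀ G → L (δ G) ≡ M (δ G)) → ∀ c → L c ≡ M c
Linear-ext {zero} {L} {M} linL linM eq c with c [] in c[]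
... | true  = begin
  L c      ≡⟨ respects linL c≗δ ⟩
  L (δ []) ≡⟨ eq [] ⟩
  M (δ []) ≡⟨ respects linM c≗δ ⟨
  M c      ∎
  where
  c≗δ : c ≗ δ []
  c≗δ [] = c[]
... | false = begin
  L c             ≡⟨ respects linL c≗0 ⟩
  L (λ _ → false) ≡⟨ trans (Linear-zero linL) (sym (Linear-zero linM)) ⟩
  M (λ _ → false) ≡⟨ respects linM c≗0 ⟨
  M c             ∎
  where
  c≗0 : c ≗ λ _ → false
  c≗0 [] = c[]
Linear-ext {suc n} {L} {M} linL linM eq c = begin
  L c
    ≡⟨ trans (respects linL (prepend-decompose c)) (additive linL (prepend false c₀) (prepend true c₁)) ⟩
  L (prepend false c₀) xor L (prepend true c₁)
    ≡⟨ cong₂ _xor_ (half false c₀) (half true c₁) ⟩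
  M (prepend false c₀) xor M (prepend true c₁)
    ≡⟨ trans (respects linM (prepend-decompose c)) (additive linM (prepend false c₀) (prepend true c₁)) ⟨
  M c ∎
  where
  c₀ = c ∘ (false ∷_)
  c₁ = c ∘ (true ∷_)

  prepend-δ : ∀ b G → prepend b (δ G) ≗ δ (b ∷ G)
  prepend-δ b G (b′ ∷ E) = refl

  half : ∀ b d → L (prepend b d) ≡ M (prepend b d)
  half b = Linear-ext (Linear-prepend linL b) (Linear-prepend linM b) λ G → begin
    L (prepend b (δ G)) ≡⟨ respects linL (prepend-δ b G) ⟩
    L (δ (b ∷ G))       ≡⟨ eq (b ∷ G) ⟩
    M (δ (b ∷ G))       ≡⟨ respects linM (prepend-δ b G) ⟨
    M (prepend b (δ G)) ∎

-- The substitution used in `≼`; on sets it is the preimage under `σ`.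
reindex : (Fin m → Fin n) → Vec Bool n → Vec Bool m
reindex σ x = tabulate (lookup x ∘ σ)

reindex-∘ : {k : ℕ} (σ : Fin m → Fin n) (τ : Fin k → Fin m) (x : Vec Bool n) →
  reindex τ (reindex σ x) ≡ reindex (σ ∘ τ) x
reindex-∘ σ τ x = tabulate-cong (lookup∘tabulate _ ∘ τ)

reindex-id : {σ : Fin n → Fin n} → (∀ i → σ i ≡ i) → (x : Vec Bool n) → reindex σ x ≡ x
reindex-id σ≗id x = trans (tabulate-cong (cong (lookup x) ∘ σ≗id)) (tabulate∘lookup x)

-- By linearity one monomial `G` suffices: the preimage of `x` under `ρ` contains `G` iff `x`
-- contains the image of `G`, and that image is the preimage under the inverse of `ρ`.
ζ-reindex : (ρ : Fin m ↔ Fin n) (c : Coefficients m) (x : Vec Bool n) →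
  ζ c (reindex (to ρ) x) ≡ ζ (c ∘ reindex (to ρ)) x
ζ-reindex ρ c x = Linear-ext {L = λ c → ζ c (reindex (to ρ) x)} {M = λ c → ζ (c ∘ reindex (to ρ)) x}
  (record { respects = λ c≗d → ζ-cong c≗d (reindex (to ρ) x)
          ; additive = λ c d → ζ-xor c d (reindex (to ρ) x) })
  (record { respects = λ c≗d → ζ-cong (c≗d ∘ reindex (to ρ)) x
          ; additive = λ c d → ζ-xor (c ∘ reindex (to ρ)) (d ∘ reindex (to ρ)) x })
  onδ c
  where
  onδ : ∀ G → ζ (δ G) (reindex (to ρ) x) ≡ ζ (δ G ∘ reindex (to ρ)) x
  onδ G = begin
    ζ (δ G) (reindex (to ρ) x)       ≡⟨ ζ-δ G (reindex (to ρ) x) ⟩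
    contains (reindex (to ρ) x) G    ≡⟨ T-ext forth back ⟩
    contains x (reindex (from ρ) G)  ≡⟨ ζ-δ (reindex (from ρ) G) x ⟨
    ζ (δ (reindex (from ρ) G)) x     ≡⟨ ζ-cong (λ E → T-ext (forthδ E) (backδ E)) x ⟩
    ζ (δ G ∘ reindex (to ρ)) x       ∎
    where
    forth : T (contains (reindex (to ρ) x) G) → T (contains x (reindex (from ρ) G))
    forth h = contains⁺ x (reindex (from ρ) G) λ i i∈G →
      subst (T ∘ lookup x) (strictlyInverseˡ ρ i)
        (subst T (lookup∘tabulate _ (from ρ i))
          (contains⁻ (reindex (to ρ) x) G h (from ρ i) (subst T (lookup∘tabulate _ i) i∈G)))

    back : T (contains x (reindex (from ρ) G)) → T (contains (reindex (to ρ) x) G)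
    back h = contains⁺ (reindex (to ρ) x) G λ i i∈G → subst T (sym (lookup∘tabulate _ i))
      (contains⁻ x (reindex (from ρ) G) h (to ρ i) (subst T (sym (lookup∘tabulate _ (to ρ i)))
        (subst (T ∘ lookup G) (sym (strictlyInverseʳ ρ i)) i∈G)))

    forthδ : ∀ E → T (δ (reindex (from ρ) G) E) → T (δ G (reindex (to ρ) E))
    forthδ E h = δ-complete _ _ (begin
      G                            ≡⟨ reindex-id (strictlyInverseʳ ρ) G ⟨
      reindex (from ρ ∘ to ρ) G        ≡⟨ reindex-∘ (from ρ) (to ρ) G ⟨
      reindex (to ρ) (reindex (from ρ) G)  ≡⟨ cong (reindex (to ρ)) (δ-sound (reindex (from ρ) G) E h) ⟩
      reindex (to ρ) E                 ∎)

    backδ : ∀ E → T (δ G (reindex (to ρ) E)) → T (δ (reindex (from ρ) G) E)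
    backδ E h = δ-complete _ _ (begin
      reindex (from ρ) G              ≡⟨ cong (reindex (from ρ)) (δ-sound G (reindex (to ρ) E) h) ⟩
      reindex (from ρ) (reindex (to ρ) E) ≡⟨ reindex-∘ (to ρ) (from ρ) E ⟩
      reindex (to ρ ∘ from ρ) E       ≡⟨ reindex-id (strictlyInverseˡ ρ) E ⟩
      E                           ∎)

ζ-restrict : (i : Fin n) (c : Coefficients n) (x : Vec Bool n) →
  ζ c (x [ i ]≔ false) ≡ ζ (λ E → c E ∧ not (lookup E i)) x
ζ-restrict zero c (b ∷ x) = cong₂ _xor_
  (ζ-cong (λ E → sym (Bool.∧-identityʳ _)) x)
  (sym (trans (cong (b ∧_) (trans (ζ-cong (λ E → Bool.∧-zeroʳ _) x) (ζ-zero x))) (Bool.∧-zeroʳ b)))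
ζ-restrict (suc i) c (b ∷ x) = cong₂ (λ u v → u xor (b ∧ v))
  (ζ-restrict i (c ∘ (false ∷_)) x) (ζ-restrict i (c ∘ (true ∷_)) x)

-- The two polynomials agree as functions, so by uniqueness of the normal form the monomials lost by
-- setting the variable to 0 were absent from the start.
ζ-inessential : (i : Fin n) (c : Coefficients n) → (∀ x → ζ c (x [ i ]≔ false) ≡ ζ c x) →
  ∀ E → T (c E) → T (not (lookup E i))
ζ-inessential i c eq E E∈c = proj₂ (⇒ Bool.T-∧ (subst T (ζ-injective c≗ E) E∈c))
  where
  c≗ : ζ c ≗ ζ (λ E → c E ∧ not (lookup E i))
  c≗ x = trans (sym (eq x)) (ζ-restrict i c x)

-- Subsets and their elements

T-not⁺ : ∀ {b} → ¬ T b → T (not b)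
T-not⁺ {true}  h = h _
T-not⁺ {false} h = _

T-not⁻ : ∀ {b} → T (not b) → ¬ T b
T-not⁻ {false} _ ()

T-false : ∀ {b} → ¬ T b → b ≡ false
T-false {true}  h = contradiction _ h
T-false {false} h = refl

T-true : ∀ {b} → T b → b ≡ true
T-true {true} _ = refl

⟦⟧-≡ : {A : Subset V} {u v : ⟦ A ⟧} → proj₁ u ≡ proj₁ v → u ≡ v
⟦⟧-≡ {u = u , p} {.u , q} refl = cong (u ,_) (Bool.T-irrelevant p q)

to-injective : {A B : Set} (φ : A ↔ B) → ∀ {x y} → to φ x ≡ to φ y → x ≡ y
to-injective φ {x} {y} eq =
  trans (sym (strictlyInverseʳ φ x)) (trans (cong (from φ) eq) (strictlyInverseʳ φ y))

extend-∈ : {A : Subset V} (E : Subset ⟦ A ⟧) (v : ⟦ A ⟧) → extend A E (proj₁ v) ≡ E v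
extend-∈ {A = A} E (v , v∈A) with Bool.T? (A v)
... | yes p  = cong (λ q → E (v , q)) (Bool.T-irrelevant p v∈A)
... | no v∉A = contradiction v∈A v∉A

extend-∉ : {A : Subset V} (E : Subset ⟦ A ⟧) {v : V} → ¬ v ∈ A → extend A E v ≡ false
extend-∉ {A = A} E {v} v∉A with Bool.T? (A v)
... | yes v∈A = contradiction v∈A v∉A
... | no _    = refl

-- Pairs of vertices

Pair : Set → Set
Pair V = [ V ]^ 2

Rest : Pair V → Set
Rest e = ⟦ ∁ (proj₁ e) ⟧

end₁ end₂ : Pair V → V
end₁ (_ , enum) = proj₁ (to enum zero)
end₂ (_ , enum) = proj₁ (to enum (suc zero))

module _ (e : Pair V) where

  end₁≢end₂ : end₁ e ≢ end₂ e
  end₁≢end₂ eq with to-injective (proj₂ e) (⟦⟧-≡ {A = proj₁ e} eq)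
  ... | ()

  end₁∈ : end₁ e ∈ proj₁ e
  end₁∈ = proj₂ (to (proj₂ e) zero)

  end₂∈ : end₂ e ∈ proj₁ e
  end₂∈ = proj₂ (to (proj₂ e) (suc zero))

  ends : ∀ {v} → v ∈ proj₁ e → v ≡ end₁ e ⊎ v ≡ end₂ e
  ends {v} v∈e with from (proj₂ e) (v , v∈e) in eq
  ... | zero     = inj₁ (cong proj₁ (sym (inverseˡ (proj₂ e) (sym eq))))
  ... | suc zero = inj₂ (cong proj₁ (sym (inverseˡ (proj₂ e) (sym eq))))

  ∈-rest : ∀ {v} → v ≢ end₁ e → v ≢ end₂ e → v ∈ ∁ (proj₁ e)
  ∈-rest v≢i v≢j = T-not⁺ ([ v≢i , v≢j ]′ ∘ ends)

  rest≢end₁ : (v : Rest e) → proj₁ v ≢ end₁ e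
  rest≢end₁ (v , v∉e) refl = T-not⁻ v∉e end₁∈

  rest≢end₂ : (v : Rest e) → proj₁ v ≢ end₂ e
  rest≢end₂ (v , v∉e) refl = T-not⁻ v∉e end₂∈

module _ (_≟_ : DecidableEquality V) where

  private
    single : V → Subset V
    single = ⁅_⁆ _≟_

  ∈-single : ∀ {v x} → v ≡ x → v ∈ single x
  ∈-single = fromWitness

  ∈-single⁻ : ∀ {v x} → v ∈ single x → v ≡ x
  ∈-single⁻ = toWitness

  -- The enumeration lists `x` before `y`, so that `end₁` and `end₂` of this pair reduce to `x` and
  -- `y`.
  pair : ∀ {x y} → x ≢ y → Pair V
  pair {x} {y} x≢y = single x ∪ single y , mk↔ₛ′ toₚ fromₚ to-from from-to
    where
    toₚ : Fin 2 → ⟦ single x ∪ single y ⟧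
    toₚ zero       = x , ⇐ Bool.T-∨ (inj₁ (∈-single refl))
    toₚ (suc zero) = y , ⇐ Bool.T-∨ (inj₂ (∈-single refl))

    pick : V → Fin 2
    pick v with v ≟ x
    ... | yes _ = zero
    ... | no _  = suc zero

    fromₚ : ⟦ single x ∪ single y ⟧ → Fin 2
    fromₚ = pick ∘ proj₁

    to-pick : ∀ {v} → v ≡ x ⊎ v ≡ y → proj₁ (toₚ (pick v)) ≡ v
    to-pick {v} v∈ with v ≟ x
    to-pick _          | yes v≡x = sym v≡x
    to-pick (inj₁ v≡x) | no v≢x  = contradiction v≡x v≢x
    to-pick (inj₂ v≡y) | no _    = sym v≡y

    to-from : ∀ v → toₚ (fromₚ v) ≡ v
    to-from (v , v∈e) = ⟦⟧-≡ {A = single x ∪ single y}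
      (to-pick ([ inj₁ ∘ ∈-single⁻ , inj₂ ∘ ∈-single⁻ ]′ (⇒ Bool.T-∨ v∈e)))

    from-to : ∀ k → fromₚ (toₚ k) ≡ k
    from-to zero with x ≟ x
    ... | yes _   = refl
    ... | no x≢x  = contradiction refl x≢x
    from-to (suc zero) with y ≟ x
    ... | yes y≡x = contradiction (sym y≡x) x≢y
    ... | no _    = refl

transpose-left : ∀ {n} (a b : Fin n) → PC.transpose a b a ≡ b
transpose-left a b rewrite dec-true (a Fin.≟ a) refl = refl

transpose-other : ∀ {n} (a b : Fin n) {c} → c ≢ a → c ≢ b → PC.transpose a b c ≡ c
transpose-other a b {c} c≢a c≢b
  rewrite dec-false (c Fin.≟ a) c≢a | dec-false (c Fin.≟ b) c≢b = refl

-- Re-enumerates the vertices with the ends of `e` in front, so that collapsing `e` amounts to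
-- identifying the first two variables.
module Front {m : ℕ} (enum : Fin (suc (suc m)) ↔ V) (e : Pair V) where

  private
    a b b′ : Fin (suc (suc m))
    a = from enum (end₁ e)
    b = from enum (end₂ e)

    τ₀ : Fin (suc (suc m)) ↔ Fin (suc (suc m))
    τ₀ = Perm.transpose zero a

    -- The position of `end₂ e` once `τ₀` has brought `end₁ e` to position 0.
    b′ = from τ₀ b

    τ₁ : Fin (suc (suc m)) ↔ Fin (suc (suc m))
    τ₁ = Perm.transpose (suc zero) b′

    b′≢0 : zero ≢ b′
    b′≢0 0≡b′ = end₁≢end₂ e (to-injective (↔-sym enum)
      (trans (sym (transpose-left zero a)) (inverseˡ τ₀ 0≡b′)))

  abstract
    front : Fin (suc (suc m)) ↔ V
    front = ↔-trans τ₁ (↔-trans τ₀ enum)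

    front₀ : to front zero ≡ end₁ e
    front₀ = begin
      to enum (to τ₀ (to τ₁ zero)) ≡⟨ cong (to enum ∘ to τ₀) (transpose-other (suc zero) b′ (λ ()) b′≢0) ⟩
      to enum (to τ₀ zero)         ≡⟨ cong (to enum) (transpose-left zero a) ⟩
      to enum a                    ≡⟨ strictlyInverseˡ enum (end₁ e) ⟩
      end₁ e                       ∎
  
    front₁ : to front (suc zero) ≡ end₂ e
    front₁ = begin
      to enum (to τ₀ (to τ₁ (suc zero))) ≡⟨ cong (to enum ∘ to τ₀) (transpose-left (suc zero) b′) ⟩
      to enum (to τ₀ b′)                 ≡⟨ cong (to enum) (strictlyInverseˡ τ₀ b) ⟩
      to enum b                          ≡⟨ strictlyInverseˡ enum (end₂ e) ⟩
      end₂ e                             ∎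
  
  front-rest : Fin m ↔ Rest e
  front-rest = mk↔ₛ′ toᵣ fromᵣ
    (λ v → ⟦⟧-≡ {A = ∁ (proj₁ e)} (trans (cong (to front) (peel-suc (nonzero v) (nonone v)))
                                          (strictlyInverseˡ front (proj₁ v))))
    (λ k → peel-unique (nonzero (toᵣ k)) (nonone (toᵣ k)) (strictlyInverseʳ front (suc (suc k))))
    where
    toᵣ : Fin m → Rest e
    toᵣ k = to front (suc (suc k)) , ∈-rest e
      (λ eq → case-0 (to-injective front (trans eq (sym front₀))))
      (λ eq → case-1 (to-injective front (trans eq (sym front₁))))
      where
      case-0 : ¬ suc (suc k) ≡ zero
      case-0 ()
      case-1 : ¬ suc (suc k) ≡ suc zero
      case-1 ()

    peel : (k : Fin (suc (suc m))) → k ≢ zero → k ≢ suc zero → Fin m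
    peel zero          k≢0 _   = contradiction refl k≢0
    peel (suc zero)    _   k≢1 = contradiction refl k≢1
    peel (suc (suc k)) _   _   = k

    peel-suc : ∀ {k} (k≢0 : k ≢ zero) (k≢1 : k ≢ suc zero) → suc (suc (peel k k≢0 k≢1)) ≡ k
    peel-suc {zero}        k≢0 _   = contradiction refl k≢0
    peel-suc {suc zero}    _   k≢1 = contradiction refl k≢1
    peel-suc {suc (suc k)} _   _   = refl

    peel-unique : ∀ {k l} (k≢0 : k ≢ zero) (k≢1 : k ≢ suc zero) → k ≡ suc (suc l) → peel k k≢0 k≢1 ≡ l
    peel-unique _ _ refl = refl

    nonzero : (v : Rest e) → from front (proj₁ v) ≢ zero
    nonzero v eq = rest≢end₁ e v (trans (sym (inverseˡ front (sym eq))) front₀)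

    nonone : (v : Rest e) → from front (proj₁ v) ≢ suc zero
    nonone v eq = rest≢end₂ e v (trans (sym (inverseˡ front (sym eq))) front₁)

    fromᵣ : Rest e → Fin m
    fromᵣ v = peel (from front (proj₁ v)) (nonzero v) (nonone v)

  front-from : (v : Rest e) → from front (proj₁ v) ≡ suc (suc (from front-rest v))
  front-from v = inverseʳ front (sym (cong proj₁ (strictlyInverseˡ front-rest v)))

-- Bijections with an added vertex, and isomorphisms

↔-Maybe : {A B : Set} → A ↔ B → Maybe A ↔ Maybe B
↔-Maybe φ = mk↔ₛ′ (Maybe.map (to φ)) (Maybe.map (from φ))
  (λ { nothing → refl ; (just b) → cong just (strictlyInverseˡ φ b) })
  (λ { nothing → refl ; (just a) → cong just (strictlyInverseʳ φ a) })

-- A bijection that fixes the new vertex sends no old vertex to it, so it restricts. The restriction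
-- is described through inverses because `image` is.
↔-Maybe⁻ : {A B : Set} (φ : Maybe A ↔ Maybe B) → to φ nothing ≡ nothing →
  Σ[ ψ ∈ (A ↔ B) ] (∀ b → from φ (just b) ≡ just (from ψ b))
↔-Maybe⁻ {A} {B} φ fixed = mk↔ₛ′ (proj₁ ∘ fwd) (proj₁ ∘ bwd)
  (λ b → just-injective (trans (sym (proj₂ (fwd _))) (inverseˡ φ (sym (proj₂ (bwd b))))))
  (λ a → just-injective (trans (sym (proj₂ (bwd _))) (inverseʳ φ (sym (proj₂ (fwd a)))))) , proj₂ ∘ bwd
  where
  fwd : (a : A) → ∃[ b ] to φ (just a) ≡ just b
  fwd a with to φ (just a) in eq
  ... | just b  = b , refl
  ... | nothing with to-injective φ (trans eq (sym fixed))
  ...   | ()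

  bwd : (b : B) → ∃[ a ] from φ (just b) ≡ just a
  bwd b with from φ (just b) in eq
  ... | just a  = a , refl
  ... | nothing with trans (sym fixed) (inverseˡ φ (sym eq))
  ...   | ()

Fin↔Maybe : ∀ {n} → Fin (suc n) ↔ Maybe (Fin n)
Fin↔Maybe = mk↔ₛ′ (λ { zero → nothing ; (suc i) → just i }) (λ { nothing → zero ; (just i) → suc i })
  (λ { nothing → refl ; (just _) → refl }) (λ { zero → refl ; (suc _) → refl })

≅-refl : {H : Hypergraph V} → H ≅ H
≅-refl = ↔-refl , λ _ → refl

≅-sym : {V V′ : Set} {H : Hypergraph V} {H′ : Hypergraph V′} → H ≅ H′ → H′ ≅ H
≅-sym {H = H} {H′} (φ , H≅H′) = ↔-sym φ , λ E → sym (trans (H≅H′ (E ∘ to φ))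
  (hyperedge-cong H′ (λ v → cong E (strictlyInverseˡ φ v))))

≅-trans : {V V′ V″ : Set} {H : Hypergraph V} {H′ : Hypergraph V′} {H″ : Hypergraph V″} →
  H ≅ H′ → H′ ≅ H″ → H ≅ H″
≅-trans (φ , p) (ψ , q) = ↔-trans φ ψ , λ E → trans (p E) (q (image φ E))

any-↔? : {A : Set} {n : ℕ} → Fin n ↔ A → {P : A → Set} → (∀ a → Dec (P a)) → Dec (∃[ a ] P a)
any-↔? enum {P} P? = map′ (λ (k , p) → to enum k , p)
  (λ (a , p) → from enum a , subst P (sym (strictlyInverseˡ enum a)) p) (Fin.any? (P? ∘ to enum))

-- Subsets relative to a pair, and the edges of H_e

module _ (_≟_ : DecidableEquality V) (H : Hypergraph V) (e : Pair V) where

  private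
    single : V → Subset V
    single = ⁅_⁆ _≟_

    H/e : Hypergraph (Maybe (Rest e))
    H/e = collapse _≟_ H e

    ext : Subset (Rest e) → Subset V
    ext = extend (∁ (proj₁ e))

  collapse-avoiding : ∀ F → F nothing ≡ false → hyperedge H/e F ≡ hyperedge H (ext (F ∘ just))
  collapse-avoiding F eq rewrite eq = refl

  collapse-through : ∀ F → F nothing ≡ true → hyperedge H/e F ≡ exactlyOneOrAll
    (hyperedge H (ext (F ∘ just) ∪ single (end₁ e)))
    (hyperedge H (ext (F ∘ just) ∪ single (end₂ e)))
    (hyperedge H (ext (F ∘ just) ∪ single (end₁ e) ∪ single (end₂ e)))
  collapse-through F eq rewrite eq = refl

-- The image of `B` under the map that sends both ends of `e` to l_e and fixes the other vertices.
_/ᵉ_ : Subset V → (e : Pair V) → Subset (Maybe (Rest e))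
(B /ᵉ e) nothing  = B (end₁ e) ∨ B (end₂ e)
(B /ᵉ e) (just v) = B (proj₁ v)

module PairSubsets (_≟_ : DecidableEquality V) where

  private
    single : V → Subset V
    single = ⁅_⁆ _≟_

  module _ (e : Pair V) where

    private
      i j : V
      i = end₁ e
      j = end₂ e

      ext : Subset (Rest e) → Subset V
      ext = extend (∁ (proj₁ e))

    data Position : V → Set where
      at₁  : Position i
      at₂  : Position j
      rest : (v : Rest e) → Position (proj₁ v)

    position : ∀ v → Position v
    position v with v ≟ i | v ≟ j
    ... | yes refl | _        = at₁
    ... | no _     | yes refl = at₂
    ... | no v≢i   | no v≢j   = rest (v , ∈-rest e v≢i v≢j)

    i∉ext : ∀ E → ¬ i ∈ ext E
    i∉ext E = subst T (extend-∉ E (λ i∈ → T-not⁻ i∈ (end₁∈ e)))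

    j∉ext : ∀ E → ¬ j ∈ ext E
    j∉ext E = subst T (extend-∉ E (λ j∈ → T-not⁻ j∈ (end₂∈ e)))

    rest∉single₁ : (v : Rest e) → ¬ proj₁ v ∈ single i
    rest∉single₁ v = rest≢end₁ e v ∘ ∈-single⁻ _≟_

    rest∉single₂ : (v : Rest e) → ¬ proj₁ v ∈ single j
    rest∉single₂ v = rest≢end₂ e v ∘ ∈-single⁻ _≟_

    -- A set is determined by its trace off `e` and its values at the two ends. With `D` one of {i},
    -- {j}, {i, j} this recognises the three sets tested by `collapse`.
    ≗-ext-∪ : ∀ {B E} (D : Subset V) → (∀ v → ¬ proj₁ v ∈ D) →
      B i ≡ D i → B j ≡ D j → (∀ v → B (proj₁ v) ≡ E v) → B ≗ ext E ∪ D
    ≗-ext-∪ {B} {E} D rest∉D eqᵢ eqⱼ eq v with position v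
    ... | at₁ = trans eqᵢ (sym (cong (_∨ D i) (T-false (i∉ext E))))
    ... | at₂ = trans eqⱼ (sym (cong (_∨ D j) (T-false (j∉ext E))))
    ... | rest w = trans (eq w) (sym (trans (cong₂ _∨_ (extend-∈ E w) (T-false (rest∉D w)))
                                            (Bool.∨-identityʳ (E w))))

    ≗-ext : ∀ {B E} → ¬ i ∈ B → ¬ j ∈ B → (∀ v → B (proj₁ v) ≡ E v) → B ≗ ext E
    ≗-ext i∉B j∉B eq v = trans
      (≗-ext-∪ (λ _ → false) (λ _ ()) (T-false i∉B) (T-false j∉B) eq v) (Bool.∨-identityʳ _)

    ext-∪⁻ : ∀ {E} (D : Subset V) → (∀ v → ¬ proj₁ v ∈ D) → ∀ v → (ext E ∪ D) (proj₁ v) ≡ E v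
    ext-∪⁻ {E} D rest∉D v = trans (cong₂ _∨_ (extend-∈ E v) (T-false (rest∉D v))) (Bool.∨-identityʳ (E v))

-- Linear spaces

-- All that is used of a Steiner system with blocks of size at least 3.
record IsLinearSpace (H : Hypergraph V) : Set where
  field
    line   : ∀ {p q} → p ≢ q → ∃[ B ] (B ∈ℰ H × p ∈ B × q ∈ B)
    unique : ∀ {p q A B} → p ≢ q → A ∈ℰ H → B ∈ℰ H → p ∈ A → q ∈ A → p ∈ B → q ∈ B → A ≗ B
    third  : ∀ {A} → A ∈ℰ H → ∀ x y → ∃[ z ] (z ∈ A × z ≢ x × z ≢ y)

exactlyOneOrAll⁻ : ∀ {a b c} → T (exactlyOneOrAll a b c) → T a ⊎ T b ⊎ T c
exactlyOneOrAll⁻ {true}                 _ = inj₁ _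
exactlyOneOrAll⁻ {false} {true}         _ = inj₂ (inj₁ _)
exactlyOneOrAll⁻ {false} {false} {true} _ = inj₂ (inj₂ _)

only₁ : ∀ {a b c} → T a → ¬ T b → ¬ T c → T (exactlyOneOrAll a b c)
only₁ {true} {true}          _ ¬b _ = contradiction _ ¬b
only₁ {true} {false} {true}  _ _ ¬c = contradiction _ ¬c
only₁ {true} {false} {false} _ _ _  = _

only₂ : ∀ {a b c} → ¬ T a → T b → ¬ T c → T (exactlyOneOrAll a b c)
only₂ {true}                 ¬a _ _ = contradiction _ ¬a
only₂ {false} {true} {true}  _ _ ¬c = contradiction _ ¬c
only₂ {false} {true} {false} _ _ _  = _

only₃ : ∀ {a b c} → ¬ T a → ¬ T b → T c → T (exactlyOneOrAll a b c)
only₃ {true}                 ¬a _ _ = contradiction _ ¬a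
only₃ {false} {true}         _ ¬b _ = contradiction _ ¬b
only₃ {false} {false} {true} _ _ _  = _

∪⁺ˡ : (A B : Subset V) {v : V} → v ∈ A → v ∈ A ∪ B
∪⁺ˡ A B v∈A = ⇐ Bool.T-∨ (inj₁ v∈A)

∪⁺ʳ : (A B : Subset V) {v : V} → v ∈ B → v ∈ A ∪ B
∪⁺ʳ A B {v} v∈B = ⇐ (Bool.T-∨ {A v}) (inj₂ v∈B)

∪⁻ : (A B : Subset V) {v : V} → v ∈ A ∪ B → v ∈ A ⊎ v ∈ B
∪⁻ A B = ⇒ Bool.T-∨

module LinearSpace (_≟_ : DecidableEquality V) {H : Hypergraph V} (linear : IsLinearSpace H) where

  open IsLinearSpace linear

  private
    single : V → Subset V
    single = ⁅_⁆ _≟_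

    ≗⇒⊆ : {A B : Subset V} → A ≗ B → A ⊆ B
    ≗⇒⊆ A≗B {v} = subst T (A≗B v)

  infixl 8 _/_
  _/_ : (H : Hypergraph V) (e : Pair V) → Hypergraph (Maybe (Rest e))
  _/_ = collapse _≟_

  -- `A` has two points besides `x`; both lie in `B`, and two points determine their block.
  ⊆-off-point : ∀ {A B} x → A ∈ℰ H → B ∈ℰ H → (∀ {v} → v ≢ x → v ∈ A → v ∈ B) → A ≗ B
  ⊆-off-point x A∈ℰ B∈ℰ A⊆B with third A∈ℰ x x
  ... | p , p∈A , p≢x , _ with third A∈ℰ x p
  ...   | q , q∈A , q≢x , q≢p = unique (q≢p ∘ sym) A∈ℰ B∈ℰ p∈A q∈A (A⊆B p≢x p∈A) (A⊆B q≢x q∈A)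

  open PairSubsets _≟_

  module _ (e : Pair V) where

    private
      i j : V
      i = end₁ e
      j = end₂ e

      ext : Subset (Rest e) → Subset V
      ext = extend (∁ (proj₁ e))

    -- If `F` contains l_e, at least one of the three tested sets is a block, and each of the three
    -- has image `F`.
    block : ∀ F → F ∈ℰ H / e → ∃[ B ] (B ∈ℰ H × F ≗ B /ᵉ e)
    block F F∈ with F nothing in eq
    ... | false = ext (F ∘ just) , F∈ , λ
      { nothing  → trans eq (sym (cong₂ _∨_ (T-false (i∉ext e (F ∘ just))) (T-false (j∉ext e (F ∘ just)))))
      ; (just v) → sym (extend-∈ (F ∘ just) v) }
    ... | true with exactlyOneOrAll⁻ F∈
    ... | inj₁ a = B , a , λ
      { nothing  → trans eq (sym (T-true (⇐ Bool.T-∨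
                     (inj₁ (∪⁺ʳ (ext (F ∘ just)) (single i) (∈-single _≟_ refl))))))
      ; (just v) → sym (ext-∪⁻ e (single i) (rest∉single₁ e) v) }
      where B = ext (F ∘ just) ∪ single i
    ... | inj₂ (inj₁ b) = B , b , λ
      { nothing  → trans eq (sym (T-true (⇐ (Bool.T-∨ {B i})
                     (inj₂ (∪⁺ʳ (ext (F ∘ just)) (single j) (∈-single _≟_ refl))))))
      ; (just v) → sym (ext-∪⁻ e (single j) (rest∉single₂ e) v) }
      where B = ext (F ∘ just) ∪ single j
    ... | inj₂ (inj₂ c) = B , c , λ
      { nothing  → trans eq (sym (T-true (⇐ Bool.T-∨ (inj₁ (∪⁺ʳ (ext (F ∘ just)) (single i ∪ single j)
                     (∪⁺ˡ (single i) (single j) (∈-single _≟_ refl)))))))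
      ; (just v) → sym (ext-∪⁻ e (single i ∪ single j)
                     (λ w → [ rest∉single₁ e w , rest∉single₂ e w ]′ ∘ ∪⁻ (single i) (single j)) v) }
      where B = ext (F ∘ just) ∪ single i ∪ single j

    -- Nothing cancels: when `B` meets `e`, it is the only block among the three tested sets.
    /-∈ℰ : ∀ {B F} → B ∈ℰ H → F ≗ B /ᵉ e → F ∈ℰ H / e
    /-∈ℰ {B} {F} B∈ℰ F≗ = by-cases (Bool.T? (B i)) (Bool.T? (B j))
      where
      X : Subset V
      X = ext (F ∘ just)

      j∉Xi : ¬ j ∈ X ∪ single i
      j∉Xi = [ j∉ext e (F ∘ just) , (λ j∈ → end₁≢end₂ e (sym (∈-single⁻ _≟_ j∈))) ]′ ∘ ∪⁻ X (single i)

      i∉Xj : ¬ i ∈ X ∪ single j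
      i∉Xj = [ i∉ext e (F ∘ just) , (λ i∈ → end₁≢end₂ e (∈-single⁻ _≟_ i∈)) ]′ ∘ ∪⁻ X (single j)

      i∈i : i ∈ single i
      i∈i = ∈-single _≟_ refl

      j∈j : j ∈ single j
      j∈j = ∈-single _≟_ refl

      X⊆B : ∀ {v} → v ∈ X → v ∈ B
      X⊆B {v} v∈X with position e v
      ... | at₁    = contradiction v∈X (i∉ext e (F ∘ just))
      ... | at₂    = contradiction v∈X (j∉ext e (F ∘ just))
      ... | rest w = subst T (trans (extend-∈ (F ∘ just) w) (F≗ (just w))) v∈X

      B⊆X : ∀ {v} → v ≢ i → v ≢ j → v ∈ B → v ∈ X
      B⊆X {v} v≢i v≢j v∈B with position e v
      ... | at₁    = contradiction refl v≢i
      ... | at₂    = contradiction refl v≢j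
      ... | rest w = subst T (sym (trans (extend-∈ (F ∘ just) w) (F≗ (just w)))) v∈B

      -- B is one of X, X ∪ {i}, X ∪ {j} and X ∪ {i, j}. As distinct blocks never agree off a
      -- single point, none of the last three is a block unless it equals B.
      Xi⇒ : (X ∪ single i) ∈ℰ H → (X ∪ single i) ≗ B
      Xi⇒ Xi∈ = ⊆-off-point i Xi∈ B∈ℰ λ v≢i →
        [ X⊆B , (λ v∈i → contradiction (∈-single⁻ _≟_ v∈i) v≢i) ]′ ∘ ∪⁻ X (single i)

      Xj⇒ : (X ∪ single j) ∈ℰ H → (X ∪ single j) ≗ B
      Xj⇒ Xj∈ = ⊆-off-point j Xj∈ B∈ℰ λ v≢j →
        [ X⊆B , (λ v∈j → contradiction (∈-single⁻ _≟_ v∈j) v≢j) ]′ ∘ ∪⁻ X (single j)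

      Xij⇒ : (X ∪ single i ∪ single j) ∈ℰ H → B ≗ (X ∪ single i ∪ single j)
      -- Here the inclusion off `i` starts from `B`, since `j` need not lie in `B`.
      Xij⇒ Xij∈ = ⊆-off-point i B∈ℰ Xij∈ λ v≢i v∈B → B⊆Xij v≢i v∈B (_ ≟ j)
        where
        B⊆Xij : ∀ {v} → v ≢ i → v ∈ B → Dec (v ≡ j) → v ∈ X ∪ single i ∪ single j
        B⊆Xij v≢i v∈B (yes v≡j) = ∪⁺ʳ X (single i ∪ single j) (∪⁺ʳ (single i) (single j) (∈-single _≟_ v≡j))
        B⊆Xij v≢i v∈B (no v≢j)  = ∪⁺ˡ X (single i ∪ single j) (B⊆X v≢i v≢j v∈B)

      i∈Xij : i ∈ X ∪ single i ∪ single j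
      i∈Xij = ∪⁺ʳ X (single i ∪ single j) (∪⁺ˡ (single i) (single j) i∈i)

      j∈Xij : j ∈ X ∪ single i ∪ single j
      j∈Xij = ∪⁺ʳ X (single i ∪ single j) (∪⁺ʳ (single i) (single j) j∈j)

      through : F nothing ≡ true → T (exactlyOneOrAll (hyperedge H (X ∪ single i))
        (hyperedge H (X ∪ single j)) (hyperedge H (X ∪ single i ∪ single j))) → F ∈ℰ H / e
      through eq = subst T (sym (collapse-through _≟_ H e F eq))

      ≗B⇒∈ : ∀ {A} → B ≗ A → A ∈ℰ H
      ≗B⇒∈ B≗A = subst T (hyperedge-cong H B≗A) B∈ℰ

      same : ∀ {A v} → T (A v) → T (B v) → B v ≡ A v
      same p q = T-ext (λ _ → p) (λ _ → q)

      differ : ∀ {A v} → ¬ T (A v) → ¬ T (B v) → B v ≡ A v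
      differ p q = trans (T-false q) (sym (T-false p))

      on-rest : ∀ v → B (proj₁ v) ≡ F (just v)
      on-rest v = sym (F≗ (just v))

      by-cases : Dec (i ∈ B) → Dec (j ∈ B) → F ∈ℰ H / e
      by-cases (no i∉B) (no j∉B) = subst T (sym (collapse-avoiding _≟_ H e F
        (trans (F≗ nothing) (cong₂ _∨_ (T-false i∉B) (T-false j∉B)))))
        (≗B⇒∈ (≗-ext e i∉B j∉B on-rest))
      by-cases (yes i∈B) (no j∉B) = through (trans (F≗ nothing) (cong (_∨ B j) (T-true i∈B))) (only₁
        (≗B⇒∈ (≗-ext-∪ e (single i) (rest∉single₁ e) (same {single i} i∈i i∈B)
          (differ {single i} (j∉Xi ∘ ∪⁺ʳ X (single i)) j∉B) on-rest))
        (λ Xj∈ → i∉Xj (subst T (sym (Xj⇒ Xj∈ i)) i∈B))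
        (λ Xij∈ → j∉B (subst T (sym (Xij⇒ Xij∈ j)) j∈Xij)))
      by-cases (no i∉B) (yes j∈B) = through (trans (F≗ nothing) (T-true (⇐ (Bool.T-∨ {B i}) (inj₂ j∈B)))) (only₂
        (λ Xi∈ → j∉Xi (subst T (sym (Xi⇒ Xi∈ j)) j∈B))
        (≗B⇒∈ (≗-ext-∪ e (single j) (rest∉single₂ e)
          (differ {single j} (i∉Xj ∘ ∪⁺ʳ X (single j)) i∉B) (same {single j} j∈j j∈B) on-rest))
        (λ Xij∈ → i∉B (subst T (sym (Xij⇒ Xij∈ i)) i∈Xij)))
      by-cases (yes i∈B) (yes j∈B) = through (trans (F≗ nothing) (cong (_∨ B j) (T-true i∈B))) (only₃
        (λ Xi∈ → j∉Xi (subst T (sym (Xi⇒ Xi∈ j)) j∈B))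
        (λ Xj∈ → i∉Xj (subst T (sym (Xj⇒ Xj∈ i)) i∈B))
        (≗B⇒∈ (≗-ext-∪ e (single i ∪ single j)
          (λ w → [ rest∉single₁ e w , rest∉single₂ e w ]′ ∘ ∪⁻ (single i) (single j))
          (same {single i ∪ single j} (∪⁺ˡ (single i) (single j) i∈i) i∈B)
          (same {single i ∪ single j} (∪⁺ʳ (single i) (single j) j∈j) j∈B) on-rest)))

  -- Blocks meeting a pair

  Meets : Subset V → Pair V → Set
  Meets B e = ∃[ u ] (u ∈ proj₁ e × u ∈ B)

  meets? : ∀ B e → Dec (Meets B e)
  meets? B e = map′
    [ (λ i∈B → end₁ e , end₁∈ e , i∈B) , (λ j∈B → end₂ e , end₂∈ e , j∈B) ]′
    (λ (u , u∈e , u∈B) → [ (λ { refl → inj₁ u∈B }) , (λ { refl → inj₂ u∈B }) ]′ (ends e u∈e))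
    (Bool.T? (B (end₁ e)) ⊎-dec Bool.T? (B (end₂ e)))

  /-meets : ∀ {B} e → Meets B e → (B /ᵉ e) nothing ≡ true
  /-meets {B} e (u , u∈e , u∈B) = T-true (⇐ (Bool.T-∨ {B (end₁ e)} {B (end₂ e)})
    ([ (λ { refl → inj₁ u∈B }) , (λ { refl → inj₂ u∈B }) ]′ (ends e u∈e)))

  /-misses : ∀ {B} e → ¬ Meets B e → (B /ᵉ e) nothing ≡ false
  /-misses e ¬meets = cong₂ _∨_ (T-false λ i∈B → ¬meets (end₁ e , end₁∈ e , i∈B))
                                (T-false λ j∈B → ¬meets (end₂ e , end₂∈ e , j∈B))

  rest≢ : ∀ {e : Pair V} {u} → u ∈ proj₁ e → (v : Rest e) → proj₁ v ≢ u
  rest≢ u∈e (v , v∉e) refl = T-not⁻ v∉e u∈e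

  rest-≟ : (e : Pair V) → DecidableEquality (Rest e)
  rest-≟ e u v = map′ (⟦⟧-≡ {A = ∁ (proj₁ e)}) (cong proj₁) (proj₁ u ≟ proj₁ v)

  -- Extending an isomorphism between the hypergraphs off two pairs

  module Transfer (e e′ : Pair V) (h : H ∖ e ≅ H ∖ e′) where

    private
      ψ : Rest e ↔ Rest e′
      ψ = proj₁ h

      ψᵛ : Rest e → V
      ψᵛ = proj₁ ∘ to ψ

      ψᵛ-≢ : ∀ {x y} → x ≢ y → ψᵛ x ≢ ψᵛ y
      ψᵛ-≢ x≢y eq = x≢y (to-injective ψ (⟦⟧-≡ {A = ∁ (proj₁ e′)} eq))

    -- A block avoiding `e′` is an edge of `H ∖ e′`, so it can be pulled back along `h`.
    pull-avoiding : ∀ {D′} → D′ ∈ℰ H → ¬ Meets D′ e′ →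
      ∃[ D ] (D ∈ℰ H × ¬ Meets D e × ∀ v → D (proj₁ v) ≡ D′ (ψᵛ v))
    pull-avoiding {D′} D′∈ℰ D′#e′ = extend (∁ (proj₁ e)) E
      , subst T (sym (trans (proj₂ h E) (hyperedge-cong H (sym ∘ D′≗)))) D′∈ℰ
      , (λ (u , u∈e , u∈D) → subst T (extend-∉ E (λ u∉e → T-not⁻ u∉e u∈e)) u∈D)
      , extend-∈ E
      where
      E : Subset (Rest e)
      E = D′ ∘ ψᵛ

      D′≗ : D′ ≗ extend (∁ (proj₁ e′)) (E ∘ from ψ)
      D′≗ = ≗-ext e′ (λ i∈ → D′#e′ (end₁ e′ , end₁∈ e′ , i∈)) (λ j∈ → D′#e′ (end₂ e′ , end₂∈ e′ , j∈))
        (λ v → cong (D′ ∘ proj₁) (sym (strictlyInverseˡ ψ v)))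

    -- If `D′` avoided `e′`, its pullback would be a block through `x` and `y` avoiding `e`; but
    -- that block is `B`, which meets `e`.
    line-meets : ∀ {B} → B ∈ℰ H → Meets B e → ∀ {x y} → x ≢ y → proj₁ x ∈ B → proj₁ y ∈ B →
      ∀ {D′} → D′ ∈ℰ H → ψᵛ x ∈ D′ → ψᵛ y ∈ D′ → Meets D′ e′
    line-meets B∈ℰ (u , u∈e , u∈B) {x} {y} x≢y x∈B y∈B {D′} D′∈ℰ x∈D′ y∈D′ with meets? D′ e′
    ... | yes meets = meets
    ... | no ¬meets with pull-avoiding D′∈ℰ ¬meets
    ...   | D , D∈ℰ , D#e , D≗ = contradiction
      (u , u∈e , ≗⇒⊆ (unique (x≢y ∘ ⟦⟧-≡ {A = ∁ (proj₁ e)}) B∈ℰ D∈ℰ x∈B y∈B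
        (subst T (sym (D≗ x)) x∈D′) (subst T (sym (D≗ y)) y∈D′)) u∈B) D#e

    -- The lines joining the images of three points of B all meet e′. If they were distinct, two of
    -- them would share an end of e′ besides the point they already have in common.
    push-line : ∀ {B} → B ∈ℰ H → Meets B e → ∀ {p q} → p ≢ q → proj₁ p ∈ B → proj₁ q ∈ B →
      ∃[ B′ ] (B′ ∈ℰ H × Meets B′ e′ × ψᵛ p ∈ B′ × ψᵛ q ∈ B′ × ∀ x → proj₁ x ∈ B → ψᵛ x ∈ B′)
    push-line {B} B∈ℰ meets {p} {q} p≢q p∈B q∈B with line (ψᵛ-≢ p≢q)
    ... | B′ , B′∈ℰ , p∈B′ , q∈B′ = B′ , B′∈ℰ , B′-meets , p∈B′ , q∈B′ , push
      where
      B′-meets : Meets B′ e′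
      B′-meets = line-meets B∈ℰ meets p≢q p∈B q∈B B′∈ℰ p∈B′ q∈B′

      two-of-three : ∀ {a b c} → a ∈ proj₁ e′ → b ∈ proj₁ e′ → c ∈ proj₁ e′ → a ≡ b ⊎ a ≡ c ⊎ b ≡ c
      two-of-three a∈ b∈ c∈ with ends e′ a∈ | ends e′ b∈ | ends e′ c∈
      ... | inj₁ refl | inj₁ refl | _         = inj₁ refl
      ... | inj₁ refl | inj₂ refl | inj₁ refl = inj₂ (inj₁ refl)
      ... | inj₁ refl | inj₂ refl | inj₂ refl = inj₂ (inj₂ refl)
      ... | inj₂ refl | inj₂ refl | _         = inj₁ refl
      ... | inj₂ refl | inj₁ refl | inj₂ refl = inj₂ (inj₁ refl)
      ... | inj₂ refl | inj₁ refl | inj₁ refl = inj₂ (inj₂ refl)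

      push : ∀ x → proj₁ x ∈ B → ψᵛ x ∈ B′
      push x x∈B with rest-≟ e x p | rest-≟ e x q
      ... | yes refl | _        = p∈B′
      ... | no _     | yes refl = q∈B′
      ... | no x≢p   | no x≢q with line (ψᵛ-≢ x≢p) | line (ψᵛ-≢ x≢q)
      ...   | C , C∈ℰ , x∈C , p∈C | D , D∈ℰ , x∈D , q∈D
        with B′-meets | line-meets B∈ℰ meets x≢p x∈B p∈B C∈ℰ x∈C p∈C
                      | line-meets B∈ℰ meets x≢q x∈B q∈B D∈ℰ x∈D q∈D
      ...     | a , a∈e′ , a∈B′ | c , c∈e′ , c∈C | d , d∈e′ , d∈D with two-of-three a∈e′ c∈e′ d∈e′
      ...       | inj₁ refl = ≗⇒⊆ (unique (rest≢ {e′} c∈e′ (to ψ p)) C∈ℰ B′∈ℰ p∈C c∈C p∈B′ a∈B′) x∈C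
      ...       | inj₂ (inj₁ refl) = ≗⇒⊆ (unique (rest≢ {e′} d∈e′ (to ψ q)) D∈ℰ B′∈ℰ q∈D d∈D q∈B′ a∈B′) x∈D
      -- `C` and `D` share an end of `e′` and the image of `x`, so they coincide; containing the
      -- images of `p` and `q`, this line is `B′`.
      ...       | inj₂ (inj₂ refl) = ≗⇒⊆ (unique (ψᵛ-≢ p≢q) C∈ℰ B′∈ℰ p∈C q∈C p∈B′ q∈B′) x∈C
        where
        q∈C : ψᵛ q ∈ C
        q∈C = ≗⇒⊆ (unique (rest≢ {e′} d∈e′ (to ψ x)) D∈ℰ C∈ℰ x∈D d∈D x∈C c∈C) q∈D

  module _ (e e′ : Pair V) (h : H ∖ e ≅ H ∖ e′) where

    private
      ψ : Rest e ↔ Rest e′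
      ψ = proj₁ h

    -- What extending `ψ` by l_e ↦ l_e′ requires of a block `B` that meets `e`.
    Pushed : Subset V → Set
    Pushed B = ∃[ B′ ] (B′ ∈ℰ H × Meets B′ e′ × ∀ v → B′ (proj₁ v) ≡ B (proj₁ (from ψ v)))

    -- `push-line` maps the trace of `B` into some `B′`. Applied to the inverse, it maps the trace
    -- of `B′` into a block through `p` and `q`, which is `B` again, so the traces correspond
    -- exactly.
    push-long : ∀ {B} → B ∈ℰ H → Meets B e → ∀ {p q} → p ≢ q → proj₁ p ∈ B → proj₁ q ∈ B → Pushed B
    push-long {B} B∈ℰ meets {p} {q} p≢q p∈B q∈B
      with Transfer.push-line e e′ h B∈ℰ meets p≢q p∈B q∈B
    ... | B′ , B′∈ℰ , B′-meets , p∈B′ , q∈B′ , push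
      with Transfer.push-line e′ e (≅-sym {H = H ∖ e} {H ∖ e′} h) B′∈ℰ B′-meets (p≢q ∘ to-injective ψ) p∈B′ q∈B′
    ... | B″ , B″∈ℰ , _ , p∈B″ , q∈B″ , pull = B′ , B′∈ℰ , B′-meets , λ v → T-ext
      (λ v∈B′ → ≗⇒⊆ B″≗B (pull v v∈B′))
      (λ v∈B → subst (_∈ B′) (cong proj₁ (strictlyInverseˡ ψ v)) (push (from ψ v) v∈B))
      where
      B″≗B : B″ ≗ B
      B″≗B = unique (p≢q ∘ ⟦⟧-≡ {A = ∁ (proj₁ e)}) B″∈ℰ B∈ℰ
        (subst (_∈ B″) (cong proj₁ (strictlyInverseʳ ψ p)) p∈B″)
        (subst (_∈ B″) (cong proj₁ (strictlyInverseʳ ψ q)) q∈B″) p∈B q∈B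

  module Finite {m : ℕ} (enum : Fin (suc (suc m)) ↔ V) where

    open Front enum

    abstract
      search : (e : Pair V) {P : Rest e → Set} → (∀ v → Dec (P v)) → Dec (∃[ v ] P v)
      search e = any-↔? (front-rest e)

      searchᵛ : {P : V → Set} → (∀ v → Dec (P v)) → Dec (∃[ v ] P v)
      searchᵛ = any-↔? enum

    module _ (e e′ : Pair V) (h : H ∖ e ≅ H ∖ e′) where

      private
        ψ : Rest e ↔ Rest e′
        ψ = proj₁ h

        h⁻¹ : H ∖ e′ ≅ H ∖ e
        h⁻¹ = ≅-sym {H = H ∖ e} {H ∖ e′} h

      -- Having at least three points, such a block consists of both ends of `e` and one point `v`
      -- off `e`. Its counterpart is the line through the image of `v` and an end of `e′`.
      push-short : ∀ {B} → B ∈ℰ H → ¬ (∃[ p ] (proj₁ p ∈ B × ∃[ q ] (p ≢ q × proj₁ q ∈ B))) → Pushed e e′ h B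
      push-short {B} B∈ℰ alone with third B∈ℰ (end₁ e) (end₂ e)
      ... | z , z∈B , z≢i , z≢j = result
        where
        v : Rest e
        v = z , ∈-rest e z≢i z≢j

        only-v : ∀ x → proj₁ x ∈ B → v ≡ x
        only-v x x∈B with rest-≟ e v x
        ... | yes v≡x = v≡x
        ... | no v≢x  = contradiction (v , z∈B , x , v≢x , x∈B) alone

        i∈B : end₁ e ∈ B
        i∈B with third B∈ℰ (end₂ e) z
        ... | y , y∈B , y≢j , y≢z with position e y
        ...   | at₁    = y∈B
        ...   | at₂    = contradiction refl y≢j
        ...   | rest x = contradiction (cong proj₁ (sym (only-v x y∈B))) y≢z

        j∈B : end₂ e ∈ B
        j∈B with third B∈ℰ (end₁ e) z
        ... | y , y∈B , y≢i , y≢z with position e y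
        ...   | at₁    = contradiction refl y≢i
        ...   | at₂    = y∈B
        ...   | rest x = contradiction (cong proj₁ (sym (only-v x y∈B))) y≢z

        e⊆B : proj₁ e ⊆ B
        e⊆B u∈e = [ (λ { refl → i∈B }) , (λ { refl → j∈B }) ]′ (ends e u∈e)

        result : Pushed e e′ h B
        result with line (rest≢ {e′} (end₁∈ e′) (to ψ v))
        ... | B′ , B′∈ℰ , v∈B′ , i′∈B′
          with search e′ (λ w → ¬? (rest-≟ e′ (to ψ v) w) ×-dec Bool.T? (B′ (proj₁ w)))
        ...   | no none = B′ , B′∈ℰ , (end₁ e′ , end₁∈ e′ , i′∈B′) , λ w → T-ext
          (λ w∈B′ → subst (λ x → proj₁ x ∈ B) (sym (inverseʳ ψ (sym (from-none w w∈B′)))) z∈B)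
          (λ w∈B → subst (λ x → proj₁ x ∈ B′) (inverseˡ ψ (only-v (from ψ w) w∈B)) v∈B′)
          where
          from-none : ∀ w → proj₁ w ∈ B′ → to ψ v ≡ w
          from-none w w∈B′ with rest-≟ e′ (to ψ v) w
          ... | yes eq = eq
          ... | no neq = contradiction (w , neq , w∈B′) none
        -- A second point `w` of `B′` off `e′` lets `push-long` pull `B′` back to a block sharing
        -- `v` and an end of `e` with `B`. That block is `B`, which has no second point off `e`.
        ...   | yes (w , v≢w , w∈B′)
          with push-long e′ e h⁻¹ B′∈ℰ (end₁ e′ , end₁∈ e′ , i′∈B′) v≢w v∈B′ w∈B′
        ...     | D , D∈ℰ , (u , u∈e , u∈D) , D≗ = contradiction (sym (inverseˡ ψ (only-v (from ψ w) w∈B)))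
                                                     (v≢w ∘ sym)
          where
          w∈B : proj₁ (from ψ w) ∈ B
          w∈B = ≗⇒⊆ (unique (rest≢ {e} u∈e v) D∈ℰ B∈ℰ (subst T (sym (D≗ v)) v∈B′) u∈D z∈B (e⊆B u∈e))
            (subst T (sym (trans (D≗ (from ψ w)) (cong (B′ ∘ proj₁) (strictlyInverseˡ ψ w)))) w∈B′)

      -- Three cases: `B` avoids `e`, or it meets `e` and has at least two points off it, or at most
      -- one. A finite search separates the last two.
      push-edge : ∀ {B} → B ∈ℰ H → ∃[ B′ ] (B′ ∈ℰ H × (B′ /ᵉ e′) nothing ≡ (B /ᵉ e) nothing ×
        ∀ v → B′ (proj₁ v) ≡ B (proj₁ (from ψ v)))
      push-edge {B} B∈ℰ with meets? B e
      ... | no ¬meets with Transfer.pull-avoiding e′ e h⁻¹ B∈ℰ ¬meets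
      ...   | B′ , B′∈ℰ , B′#e′ , eq = B′ , B′∈ℰ , trans (/-misses e′ B′#e′) (sym (/-misses e ¬meets)) , eq
      push-edge {B} B∈ℰ | yes meets
        with search e (λ p → Bool.T? (B (proj₁ p)) ×-dec
                           search e (λ q → ¬? (rest-≟ e p q) ×-dec Bool.T? (B (proj₁ q))))
      ...   | yes (p , p∈B , q , p≢q , q∈B) with push-long e e′ h B∈ℰ meets p≢q p∈B q∈B
      ...     | B′ , B′∈ℰ , B′-meets , eq = B′ , B′∈ℰ , trans (/-meets e′ B′-meets) (sym (/-meets e meets)) , eq
      push-edge {B} B∈ℰ | yes meets | no alone with push-short B∈ℰ alone
      ...     | B′ , B′∈ℰ , B′-meets , eq = B′ , B′∈ℰ , trans (/-meets e′ B′-meets) (sym (/-meets e meets)) , eq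

      push-/ : ∀ F → F ∈ℰ H / e → (F ∘ Maybe.map (from ψ)) ∈ℰ H / e′
      push-/ F F∈ with block e F F∈
      ... | B , B∈ℰ , F≗ with push-edge B∈ℰ
      ...   | B′ , B′∈ℰ , eq₀ , eq = /-∈ℰ e′ {F = F ∘ Maybe.map (from ψ)} B′∈ℰ λ
        { nothing  → trans (F≗ nothing) (sym eq₀)
        ; (just v) → trans (F≗ (just (from ψ v))) (sym (eq v)) }

    -- The bijection is extended by l_e ↦ l_e′; edges are reflected because `push-/` also applies to
    -- the inverse.
    ∖-≅⇒/-≅ : (e e′ : Pair V) → H ∖ e ≅ H ∖ e′ → H / e ≅ H / e′
    ∖-≅⇒/-≅ e e′ h = ↔-Maybe (proj₁ h) , λ F → T-ext (push-/ e e′ h F) λ F′∈ →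
      subst T (hyperedge-cong (H / e) (λ v → cong F (strictlyInverseʳ (↔-Maybe (proj₁ h)) v)))
        (push-/ e′ e (≅-sym {H = H ∖ e} {H ∖ e′} h) (F ∘ Maybe.map (from (proj₁ h))) F′∈)

    -- Restricting an isomorphism from H_e to H_e′

    module _ (e e′ : Pair V) (h : H / e ≅ H / e′) where

      private
        φ : Maybe (Rest e) ↔ Maybe (Rest e′)
        φ = proj₁ h

        i j : V
        i = end₁ e
        j = end₂ e

      -- Edges are images of blocks, and the identification leaves `a` and `b` alone, so the
      -- underlying blocks already share these two points.
      /-unique : ∀ {F G} → F ∈ℰ H / e′ → G ∈ℰ H / e′ → ∀ {a b} → a ≢ b →
        just a ∈ F → just b ∈ F → just a ∈ G → just b ∈ G → F ≗ G
      /-unique {F} {G} F∈ G∈ {a} {b} a≢b a∈F b∈F a∈G b∈G with block e′ F F∈ | block e′ G G∈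
      ... | B , B∈ℰ , F≗ | C , C∈ℰ , G≗ = λ
        { nothing  → trans (F≗ nothing) (trans (cong₂ _∨_ (B≗C (end₁ e′)) (B≗C (end₂ e′))) (sym (G≗ nothing)))
        ; (just v) → trans (F≗ (just v)) (trans (B≗C (proj₁ v)) (sym (G≗ (just v)))) }
        where
        B≗C : B ≗ C
        B≗C = unique (a≢b ∘ ⟦⟧-≡ {A = ∁ (proj₁ e′)}) B∈ℰ C∈ℰ
          (subst T (F≗ (just a)) a∈F) (subst T (F≗ (just b)) b∈F)
          (subst T (G≗ (just a)) a∈G) (subst T (G≗ (just b)) b∈G)

      module _ {B : Subset V} (B∈ℰ : B ∈ℰ H) (i∈B : i ∈ B) (j∈B : j ∈ B) where

        off-line : ∀ {w} → ¬ w ∈ B → Rest e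
        off-line {w} w∉B = w , ∈-rest e (λ { refl → w∉B i∈B }) (λ { refl → w∉B j∈B })

        -- B₁ /ᵉ e and B₂ /ᵉ e are distinct edges sharing l_e and w, whereas two distinct edges
        -- never share two vertices other than l_e. As z is another such w, this identifies l_e.
        off-line-edges : ∀ {w} (w∉B : ¬ w ∈ B) →
          ∃[ B₁ ] ∃[ B₂ ] (B₁ ∈ℰ H × B₂ ∈ℰ H × i ∈ B₁ × j ∈ B₂ × w ∈ B₁ × w ∈ B₂ ×
            Σ[ z ∈ Rest e ] (¬ proj₁ z ∈ B × proj₁ z ≢ w × proj₁ z ∈ B₁ × ¬ proj₁ z ∈ B₂))
        off-line-edges {w} w∉B
          with line (rest≢ {e} (end₁∈ e) (off-line w∉B)) | line (rest≢ {e} (end₂∈ e) (off-line w∉B))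
        ... | B₁ , B₁∈ℰ , w∈B₁ , i∈B₁ | B₂ , B₂∈ℰ , w∈B₂ , j∈B₂ with third B₁∈ℰ i w
        ...   | z , z∈B₁ , z≢i , z≢w =
          B₁ , B₂ , B₁∈ℰ , B₂∈ℰ , i∈B₁ , j∈B₂ , w∈B₁ , w∈B₂ , off-line z∉B , z∉B , z≢w , z∈B₁ , z∉B₂
          where
          j∉B₁ : ¬ j ∈ B₁
          j∉B₁ j∈B₁ = w∉B (≗⇒⊆ (unique (end₁≢end₂ e) B₁∈ℰ B∈ℰ i∈B₁ j∈B₁ i∈B j∈B) w∈B₁)

          z∉B : ¬ z ∈ B
          z∉B z∈B = w∉B (≗⇒⊆ (unique z≢i B₁∈ℰ B∈ℰ z∈B₁ i∈B₁ z∈B i∈B) w∈B₁)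

          z∉B₂ : ¬ z ∈ B₂
          z∉B₂ z∈B₂ = j∉B₁ (≗⇒⊆ (unique z≢w B₂∈ℰ B₁∈ℰ z∈B₂ w∈B₂ z∈B₁ w∈B₁) j∈B₂)

        -- Otherwise l_e and `w` would both go to vertices other than l_e′, and the two edges of
        -- `off-line-edges` through them would coincide by `/-unique`; the vertex `z` tells them
        -- apart.
        off-line↦nothing : ∀ {a′} → to φ nothing ≡ just a′ → ∀ {w} (w∉B : ¬ w ∈ B) →
          to φ (just (off-line w∉B)) ≡ nothing
        off-line↦nothing {a′} φ-nothing {w} w∉B with to φ (just (off-line w∉B)) in φ-w
        ... | nothing = refl
        ... | just b′ with off-line-edges w∉B
        ...   | B₁ , B₂ , B₁∈ℰ , B₂∈ℰ , i∈B₁ , j∈B₂ , w∈B₁ , w∈B₂ , z , _ , _ , z∈B₁ , z∉B₂ =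
          contradiction (subst T (F₁≗F₂ (just z)) z∈B₁) z∉B₂
          where
          push : ∀ {A} → A ∈ℰ H → ((A /ᵉ e) ∘ from φ) ∈ℰ H / e′
          push {A} A∈ℰ = subst T (proj₂ h (A /ᵉ e)) (/-∈ℰ e A∈ℰ (λ _ → refl))

          at : ∀ {A x y} → to φ x ≡ y → x ∈ A /ᵉ e → y ∈ (A /ᵉ e) ∘ from φ
          at {A} refl = subst (λ x → x ∈ A /ᵉ e) (sym (strictlyInverseʳ φ _))

          nothing≢just : a′ ≢ b′
          nothing≢just refl with to-injective φ (trans φ-nothing (sym φ-w))
          ... | ()

          G₁≗G₂ : (B₁ /ᵉ e) ∘ from φ ≗ (B₂ /ᵉ e) ∘ from φ
          G₁≗G₂ = /-unique (push B₁∈ℰ) (push B₂∈ℰ) nothing≢just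
            (at {B₁} φ-nothing (⇐ Bool.T-∨ (inj₁ i∈B₁))) (at {B₁} φ-w w∈B₁)
            (at {B₂} φ-nothing (⇐ (Bool.T-∨ {B₂ i}) (inj₂ j∈B₂))) (at {B₂} φ-w w∈B₂)

          F₁≗F₂ : B₁ /ᵉ e ≗ B₂ /ᵉ e
          F₁≗F₂ x = subst (λ x → (B₁ /ᵉ e) x ≡ (B₂ /ᵉ e) x) (strictlyInverseʳ φ x) (G₁≗G₂ (to φ x))

        -- If l_e were moved, the distinct vertices `w` and `z` off the line would both be sent to
        -- l_e′.
        nothing-fixed : ∀ {w} → ¬ w ∈ B → to φ nothing ≡ nothing
        nothing-fixed {w} w∉B with to φ nothing in φ-nothing
        ... | nothing = refl
        ... | just a′ with off-line-edges w∉B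
        ...   | _ , _ , _ , _ , _ , _ , _ , _ , z , z∉B , z≢w , _ , _ = contradiction
          (cong proj₁ (just-injective (to-injective φ
            (trans (off-line↦nothing φ-nothing z∉B) (sym (off-line↦nothing φ-nothing w∉B)))))) z≢w

      fixed⇒∖-≅ : to φ nothing ≡ nothing → H ∖ e ≅ H ∖ e′
      fixed⇒∖-≅ φ-nothing = ψ , iso
        where
        ψ : Rest e ↔ Rest e′
        ψ = proj₁ (↔-Maybe⁻ φ φ-nothing)

        iso : ∀ E → hyperedge (H ∖ e) E ≡ hyperedge (H ∖ e′) (image ψ E)
        iso E = begin
          hyperedge (H ∖ e) E
            ≡⟨ collapse-avoiding _≟_ H e F refl ⟨
          hyperedge (H / e) F
            ≡⟨ proj₂ h F ⟩
          hyperedge (H / e′) (F ∘ from φ)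
            ≡⟨ collapse-avoiding _≟_ H e′ (F ∘ from φ) (cong F (inverseʳ φ (sym φ-nothing))) ⟩
          hyperedge (H ∖ e′) (F ∘ from φ ∘ just)
            ≡⟨ hyperedge-cong (H ∖ e′) (λ v → cong F (proj₂ (↔-Maybe⁻ φ φ-nothing) v)) ⟩
          hyperedge (H ∖ e′) (image ψ E) ∎
          where
          F : Subset (Maybe (Rest e))
          F nothing  = false
          F (just v) = E v

    /-≅⇒∖-≅ : (e e′ : Pair V) → H / e ≅ H / e′ → H ∖ e ≅ H ∖ e′
    /-≅⇒∖-≅ e e′ h with line (end₁≢end₂ e)
    ... | B , B∈ℰ , i∈B , j∈B with searchᵛ (λ w → ¬? (Bool.T? (B w)))
    ...   | yes (w , w∉B) = fixed⇒∖-≅ e e′ h (nothing-fixed e e′ h B∈ℰ i∈B j∈B w∉B)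
    -- The line through `e` is the whole vertex set, hence the only block. Deleting any pair leaves
    -- no edges, and every bijection is an isomorphism.
    ...   | no none = ↔-trans (↔-sym (front-rest e)) (front-rest e′) ,
        λ E → trans (edgeless e E) (sym (edgeless e′ _))
      where
      full : ∀ w → w ∈ B
      full w with Bool.T? (B w)
      ... | yes w∈B = w∈B
      ... | no w∉B  = contradiction (w , w∉B) none

      edgeless : ∀ e E → hyperedge (H ∖ e) E ≡ false
      edgeless e E = T-false λ E∈ → i∉ext e E
        (subst T (sym (⊆-off-point (end₁ e) E∈ B∈ℰ (λ _ _ → full _) (end₁ e))) (full (end₁ e)))

-- Steiner systems: blocks of size two and of size at least three

image-size : {A : Subset V} {k : ℕ} (π : V ↔ V) → HasSize A k → HasSize (image π A) k
image-size {A = A} π size = ↔-trans size (mk↔ₛ′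
  (λ (v , v∈A) → to π v , subst (_∈ A) (sym (strictlyInverseʳ π v)) v∈A)
  (λ (v , v∈) → from π v , v∈)
  (λ (v , _) → ⟦⟧-≡ {A = image π A} (strictlyInverseˡ π v))
  (λ (v , _) → ⟦⟧-≡ {A = A} (strictlyInverseʳ π v)))

module _ {H : Hypergraph V} (steiner : IsSteinerSystem n H) where

  open IsSteinerSystem steiner

  -- The block covering `E` has two elements itself, so it equals `E`.
  graph-complete : k ≡ 2 → ((E , _) : Pair V) → E ∈ℰ H
  graph-complete refl e@(E , _) with cover e
  ... | B , (B∈ℰ , E⊆B) , _ = subst T (hyperedge-cong H λ v → T-ext B⊆E E⊆B) B∈ℰ
    where
    b : Pair V
    b = B , uniform B B∈ℰ

    B⊆E : B ⊆ E
    B⊆E v∈B with ends b v∈B | ends b (E⊆B (end₁∈ e)) | ends b (E⊆B (end₂∈ e))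
    ... | _         | inj₁ p | inj₁ q = contradiction (trans p (sym q)) (end₁≢end₂ e)
    ... | _         | inj₂ p | inj₂ q = contradiction (trans p (sym q)) (end₁≢end₂ e)
    ... | inj₁ refl | inj₁ p | inj₂ _ = subst (_∈ E) p (end₁∈ e)
    ... | inj₁ refl | inj₂ _ | inj₁ q = subst (_∈ E) q (end₂∈ e)
    ... | inj₂ refl | inj₁ _ | inj₂ q = subst (_∈ E) q (end₂∈ e)
    ... | inj₂ refl | inj₂ p | inj₁ _ = subst (_∈ E) p (end₁∈ e)

  -- The edges are all the pairs, and a permutation maps pairs to pairs.
  graph-symmetric : k ≡ 2 → (π : V ↔ V) → ∀ E → hyperedge H (image π E) ≡ hyperedge H E
  graph-symmetric k≡2 π E = T-ext
    (λ πE∈ → subst T (hyperedge-cong H (λ v → cong E (strictlyInverseʳ π v))) (push (↔-sym π) (image π E) πE∈))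
    (push π E)
    where
    push : (π : V ↔ V) → ∀ E → E ∈ℰ H → image π E ∈ℰ H
    push π E E∈ = graph-complete k≡2 (image π E , subst (HasSize _) k≡2 (image-size {A = E} π (uniform E E∈)))

  third-point : DecidableEquality V → 3 ≤ k → ∀ {A} → A ∈ℰ H → ∀ x y → ∃[ z ] (z ∈ A × z ≢ x × z ≢ y)
  third-point _≟_ (s≤s (s≤s (s≤s _))) {A} A∈ℰ x y = choose (a₀ ≟ x) (a₀ ≟ y) (a₁ ≟ x) (a₁ ≟ y)
    where
    a : Fin k → ⟦ A ⟧
    a = to (uniform A A∈ℰ)
    a₀ a₁ a₂ : V
    a₀ = proj₁ (a zero)
    a₁ = proj₁ (a (suc zero))
    a₂ = proj₁ (a (suc (suc zero)))

    distinct : ∀ {i j} → i ≢ j → proj₁ (a i) ≢ proj₁ (a j)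
    distinct i≢j eq = i≢j (to-injective (uniform A A∈ℰ) (⟦⟧-≡ {A = A} eq))

    a₁≢a₀ : a₁ ≢ a₀
    a₁≢a₀ = distinct λ ()
    a₂≢a₀ : a₂ ≢ a₀
    a₂≢a₀ = distinct λ ()
    a₂≢a₁ : a₂ ≢ a₁
    a₂≢a₁ = distinct λ ()

    choose : Dec (a₀ ≡ x) → Dec (a₀ ≡ y) → Dec (a₁ ≡ x) → Dec (a₁ ≡ y) → ∃[ z ] (z ∈ A × z ≢ x × z ≢ y)
    choose (no ≢x)  (no ≢y)   _         _        = a₀ , proj₂ (a zero) , ≢x , ≢y
    choose (yes refl) _       _         (no ≢y)  = a₁ , proj₂ (a (suc zero)) , a₁≢a₀ , ≢y
    choose (yes refl) _       _       (yes refl) = a₂ , proj₂ (a (suc (suc zero))) , a₂≢a₀ , a₂≢a₁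
    choose (no _) (yes refl) (no ≢x)   _         = a₁ , proj₂ (a (suc zero)) , ≢x , a₁≢a₀
    choose (no _) (yes refl) (yes refl) _        = a₂ , proj₂ (a (suc (suc zero))) , a₂≢a₁ , a₂≢a₀

  module _ (_≟_ : DecidableEquality V) where

    steiner-line : ∀ {p q} → p ≢ q → ∃[ B ] (B ∈ℰ H × p ∈ B × q ∈ B)
    steiner-line p≢q with cover (pair _≟_ p≢q)
    ... | B , (B∈ℰ , e⊆B) , _ = B , B∈ℰ , e⊆B (end₁∈ (pair _≟_ p≢q)) , e⊆B (end₂∈ (pair _≟_ p≢q))

    steiner-unique : ∀ {p q A B} → p ≢ q → A ∈ℰ H → B ∈ℰ H → p ∈ A → q ∈ A → p ∈ B → q ∈ B → A ≗ B
    steiner-unique {p} {q} {A} {B} p≢q A∈ℰ B∈ℰ p∈A q∈A p∈B q∈B v =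
      trans (sym (proj₂ (proj₂ (cover e)) (A∈ℰ , e⊆ A p∈A q∈A) v))
            (proj₂ (proj₂ (cover e)) (B∈ℰ , e⊆ B p∈B q∈B) v)
      where
      e : Pair V
      e = pair _≟_ p≢q

      e⊆ : ∀ C → p ∈ C → q ∈ C → proj₁ e ⊆ C
      e⊆ C p∈C q∈C v∈e = [ (λ { refl → p∈C }) , (λ { refl → q∈C }) ]′ (ends e v∈e)

    steiner-linear : 3 ≤ k → IsLinearSpace H
    steiner-linear 3≤k = record
      { line = steiner-line ; unique = steiner-unique ; third = third-point _≟_ 3≤k }

-- Hypergraphs invariant under all permutations

module _ (_≟_ : DecidableEquality V) (enum : Fin (suc (suc m)) ↔ V) {H : Hypergraph V}
  (symmetric : (π : V ↔ V) → ∀ E → hyperedge H (image π E) ≡ hyperedge H E) (e e′ : Pair V) where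

  open PairSubsets _≟_

  private
    single : V → Subset V
    single = ⁅_⁆ _≟_

    -- `π` carries the ends of `e` to those of `e′` in order, and `ψ` is its restriction off the
    -- pairs.
    π : V ↔ V
    π = ↔-trans (↔-sym (Front.front enum e)) (Front.front enum e′)

    ψ : Rest e ↔ Rest e′
    ψ = ↔-trans (↔-sym (Front.front-rest enum e)) (Front.front-rest enum e′)

    from-π₁ : from π (end₁ e′) ≡ end₁ e
    from-π₁ = trans (cong (to (Front.front enum e)) (inverseʳ (Front.front enum e′) (sym (Front.front₀ enum e′))))
                    (Front.front₀ enum e)

    from-π₂ : from π (end₂ e′) ≡ end₂ e
    from-π₂ = trans (cong (to (Front.front enum e)) (inverseʳ (Front.front enum e′) (sym (Front.front₁ enum e′))))
                    (Front.front₁ enum e)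

    from-π : ∀ v → from π (proj₁ v) ≡ proj₁ (from ψ v)
    from-π v = cong (to (Front.front enum e)) (Front.front-from enum e′ v)

    image-extend : ∀ E → image π (extend (∁ (proj₁ e)) E) ≗ extend (∁ (proj₁ e′)) (image ψ E)
    image-extend E = ≗-ext e′
      (i∉ext e E ∘ subst (_∈ extend (∁ (proj₁ e)) E) from-π₁)
      (j∉ext e E ∘ subst (_∈ extend (∁ (proj₁ e)) E) from-π₂)
      (λ v → trans (cong (extend (∁ (proj₁ e)) E) (from-π v)) (extend-∈ E (from ψ v)))

    image-single : ∀ {x x′} → from π x′ ≡ x → image π (single x) ≗ single x′
    image-single {x} {x′} eq v = T-ext
      (λ h → ∈-single _≟_ (to-injective (↔-sym π) (trans (∈-single⁻ _≟_ h) (sym eq))))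
      (λ h → ∈-single _≟_ (trans (cong (from π) (∈-single⁻ _≟_ h)) eq))

    transport : ∀ {A B} → image π A ≗ B → hyperedge H A ≡ hyperedge H B
    transport {A} eq = trans (sym (symmetric π A)) (hyperedge-cong H eq)

  symmetric-∖ : H ∖ e ≅ H ∖ e′
  symmetric-∖ = ψ , λ E → transport (image-extend E)

  symmetric-/ : collapse _≟_ H e ≅ collapse _≟_ H e′
  symmetric-/ = ↔-Maybe ψ , λ F → by-cases F (F nothing) refl
    where
    H/_ : (e : Pair V) → Hypergraph (Maybe (Rest e))
    H/_ = collapse _≟_ H

    by-cases : ∀ F b → F nothing ≡ b → hyperedge (H/ e) F ≡ hyperedge (H/ e′) (F ∘ Maybe.map (from ψ))
    by-cases F false eq = begin
      hyperedge (H/ e) F                            ≡⟨ collapse-avoiding _≟_ H e F eq ⟩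
      hyperedge (H ∖ e) (F ∘ just)                  ≡⟨ transport (image-extend (F ∘ just)) ⟩
      hyperedge (H ∖ e′) (image ψ (F ∘ just))       ≡⟨ collapse-avoiding _≟_ H e′ (F ∘ Maybe.map (from ψ)) eq ⟨
      hyperedge (H/ e′) (F ∘ Maybe.map (from ψ))    ∎
    by-cases F true eq = begin
      hyperedge (H/ e) F
        ≡⟨ collapse-through _≟_ H e F eq ⟩
      exactlyOneOrAll (hyperedge H (X ∪ i)) (hyperedge H (X ∪ j)) (hyperedge H (X ∪ i ∪ j))
        ≡⟨ cong₂ (λ a (b , c) → exactlyOneOrAll a b c)
             (transport {X ∪ i} {X′ ∪ i′} λ v → cong₂ _∨_ (eqX v) (eqᵢ v))
             (cong₂ _,_ (transport {X ∪ j} {X′ ∪ j′} λ v → cong₂ _∨_ (eqX v) (eqⱼ v))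
               (transport {X ∪ i ∪ j} {X′ ∪ i′ ∪ j′} λ v → cong₂ _∨_ (eqX v) (cong₂ _∨_ (eqᵢ v) (eqⱼ v)))) ⟩
      exactlyOneOrAll (hyperedge H (X′ ∪ i′)) (hyperedge H (X′ ∪ j′)) (hyperedge H (X′ ∪ i′ ∪ j′))
        ≡⟨ collapse-through _≟_ H e′ (F ∘ Maybe.map (from ψ)) eq ⟨
      hyperedge (H/ e′) (F ∘ Maybe.map (from ψ)) ∎
      where
      X X′ i i′ j j′ : Subset V
      X  = extend (∁ (proj₁ e)) (F ∘ just)
      X′ = extend (∁ (proj₁ e′)) (image ψ (F ∘ just))
      i  = single (end₁ e)
      j  = single (end₂ e)
      i′ = single (end₁ e′)
      j′ = single (end₂ e′)

      eqX : image π X ≗ X′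
      eqX = image-extend (F ∘ just)
      eqᵢ : image π i ≗ i′
      eqᵢ = image-single from-π₁
      eqⱼ : image π j ≗ j′
      eqⱼ = image-single from-π₂

-- Simple minors

-- In terms of the normal form: every variable occurs in some monomial, so the function depends on
-- all its variables.
Covered : Hypergraph V → Set
Covered {V} H = (v : V) → ∃[ E ] (E ∈ℰ H × v ∈ E)

≼-trans : ∀ {f g h} → f ≼ g → g ≼ h → f ≼ h
≼-trans {h = h} (σ , f≗) (τ , g≗) = σ ∘ τ , λ x →
  trans (f≗ x) (trans (g≗ (reindex σ x)) (cong (eval h) (reindex-∘ σ τ x)))

coefficients-tabulate : (enum : Fin n ↔ V) (H : Hypergraph V) (A : Subset V) →
  coefficients enum H (tabulate (A ∘ to enum)) ≡ hyperedge H A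
coefficients-tabulate enum H A = hyperedge-cong H λ v →
  trans (lookup∘tabulate (A ∘ to enum) (from enum v)) (cong A (strictlyInverseˡ enum v))

-- An isomorphism renames variables. The map required by `≼` runs from the variables of the
-- right-hand function to those of the left, whence the inverse of `φ` in `ρ`.
≅⇒≼ : .{{_ : NonZero n}} .{{_ : NonZero n′}} (enum : Fin n ↔ V) (enum′ : Fin n′ ↔ V′)
  {H : Hypergraph V} {H′ : Hypergraph V′} → H ≅ H′ → booleanFunction enum H ≼ booleanFunction enum′ H′
≅⇒≼ enum enum′ {H} {H′} (φ , H≅H′) = to ρ , λ x → begin
  polynomial enum H x                                  ≡⟨ polynomial-ζ enum H x ⟩
  ζ (coefficients enum H) x                            ≡⟨ ζ-cong coefficients-ρ x ⟩
  ζ (coefficients enum′ H′ ∘ reindex (to ρ)) x         ≡⟨ ζ-reindex ρ (coefficients enum′ H′) x ⟨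
  ζ (coefficients enum′ H′) (reindex (to ρ) x)         ≡⟨ polynomial-ζ enum′ H′ (reindex (to ρ) x) ⟨
  polynomial enum′ H′ (reindex (to ρ) x)               ∎
  where
  ρ : Fin _ ↔ Fin _
  ρ = ↔-trans enum′ (↔-trans (↔-sym φ) (↔-sym enum))

  coefficients-ρ : coefficients enum H ≗ coefficients enum′ H′ ∘ reindex (to ρ)
  coefficients-ρ E = trans (H≅H′ (image enum (lookup E)))
    (sym (coefficients-tabulate enum′ H′ (image φ (image enum (lookup E)))))

-- A variable missed by `σ` would be inessential, whereas some monomial contains it.
≼⇒surjective : .{{_ : NonZero n}} (enum : Fin n ↔ V) {H : Hypergraph V} → Covered H →
  ∀ {g} ((σ , _) : booleanFunction enum H ≼ g) → ∀ i → ∃[ k ] σ k ≡ i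
≼⇒surjective enum {H} covered {g} (σ , f≗) i with Fin.any? (λ k → σ k Fin.≟ i)
... | yes found = found
... | no none = contradiction i∈E (T-not⁻ (ζ-inessential i c inessential E E∈))
  where
  c = coefficients enum H

  A : Subset _
  A = proj₁ (covered (to enum i))

  E : Vec Bool _
  E = tabulate (A ∘ to enum)

  E∈ : T (c E)
  E∈ = subst T (sym (coefficients-tabulate enum H A))
    (proj₁ (proj₂ (covered (to enum i))))

  i∈E : T (lookup E i)
  i∈E = subst T (sym (lookup∘tabulate (A ∘ to enum) i)) (proj₂ (proj₂ (covered (to enum i))))

  inessential : ∀ x → ζ c (x [ i ]≔ false) ≡ ζ c x
  inessential x = begin
    ζ c (x [ i ]≔ false)                  ≡⟨ polynomial-ζ enum H (x [ i ]≔ false) ⟨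
    polynomial enum H (x [ i ]≔ false)    ≡⟨ f≗ (x [ i ]≔ false) ⟩
    eval g (reindex σ (x [ i ]≔ false))   ≡⟨ cong (eval g) (tabulate-cong λ k →
                                               lookup∘update′ (λ σk≡i → none (k , σk≡i)) x false) ⟩
    eval g (reindex σ x)                  ≡⟨ f≗ x ⟨
    polynomial enum H x                   ≡⟨ polynomial-ζ enum H x ⟩
    ζ c x                                 ∎

section-injective : {A B : Set} {σ : A → B} (τ : (b : B) → ∃[ a ] σ a ≡ b) → Injective _≡_ _≡_ (proj₁ ∘ τ)
section-injective {σ = σ} τ {x} {y} eq = trans (sym (proj₂ (τ x))) (trans (cong σ eq) (proj₂ (τ y)))

-- Pigeonhole: deleting a missed value would embed `Fin (suc n)` into `Fin n`.
injective⇒surjective : {τ : Fin n → Fin n} → Injective _≡_ _≡_ τ → ∀ i → ∃[ k ] τ k ≡ i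
injective⇒surjective {suc n} {τ} inj i with Fin.any? (λ k → τ k Fin.≟ i)
... | yes found = found
... | no none = contradiction
  (Fin.injective⇒≤ {f = λ k → punchOut (missed k)}
    (λ {k} {l} → inj ∘ Fin.punchOut-injective (missed k) (missed l)))
  ℕ.1+n≰n
  where
  missed : ∀ k → i ≢ τ k
  missed k eq = none (k , sym eq)

-- As the arities agree, the surjection `σ` is a bijection; uniqueness of the normal form then turns
-- equality of functions into equality of edges.
≼⇒≅ : .{{_ : NonZero n}} (enum : Fin n ↔ V) (enum′ : Fin n ↔ V′) {H : Hypergraph V} {H′ : Hypergraph V′} →
  Covered H → booleanFunction enum H ≼ booleanFunction enum′ H′ → H ≅ H′
≼⇒≅ {n} enum enum′ {H} {H′} covered h@(σ , f≗) = ↔-trans (↔-sym enum) (↔-trans (↔-sym ρ) enum′) , λ A → begin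
  hyperedge H A
    ≡⟨ coefficients-tabulate enum H A ⟨
  coefficients enum H (tabulate (A ∘ to enum))
    ≡⟨ coefficients-σ (tabulate (A ∘ to enum)) ⟩
  coefficients enum′ H′ (reindex σ (tabulate (A ∘ to enum)))
    ≡⟨ hyperedge-cong H′ (λ v → trans (lookup∘tabulate (lookup (tabulate (A ∘ to enum)) ∘ σ) (from enum′ v))
                                      (lookup∘tabulate (A ∘ to enum) (σ (from enum′ v)))) ⟩
  hyperedge H′ (A ∘ to enum ∘ σ ∘ from enum′) ∎
  where
  σ-surjective : ∀ i → ∃[ k ] σ k ≡ i
  σ-surjective = ≼⇒surjective enum {H} covered {booleanFunction enum′ H′} h

  τ : Fin n → Fin n
  τ = proj₁ ∘ σ-surjective

  -- A section of `σ` is injective, hence surjective on a finite set, hence a two-sided inverse.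
  τσ : ∀ k → τ (σ k) ≡ k
  τσ k with injective⇒surjective (section-injective {σ = σ} σ-surjective) k
  ... | i , refl = cong τ (proj₂ (σ-surjective i))

  ρ : Fin n ↔ Fin n
  ρ = mk↔ₛ′ σ τ (proj₂ ∘ σ-surjective) τσ

  coefficients-σ : coefficients enum H ≗ coefficients enum′ H′ ∘ reindex σ
  coefficients-σ = ζ-injective λ x → begin
    ζ (coefficients enum H) x                    ≡⟨ polynomial-ζ enum H x ⟨
    polynomial enum H x                          ≡⟨ f≗ x ⟩
    polynomial enum′ H′ (reindex σ x)            ≡⟨ polynomial-ζ enum′ H′ (reindex σ x) ⟩
    ζ (coefficients enum′ H′) (reindex σ x)      ≡⟨ ζ-reindex ρ (coefficients enum′ H′) x ⟩
    ζ (coefficients enum′ H′ ∘ reindex σ) x      ∎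

-- Identifying two variables

exactlyOneOrAll-xor : ∀ a b c → exactlyOneOrAll a b c ≡ a xor (b xor c)
exactlyOneOrAll-xor true  true  true  = refl
exactlyOneOrAll-xor true  true  false = refl
exactlyOneOrAll-xor true  false true  = refl
exactlyOneOrAll-xor true  false false = refl
exactlyOneOrAll-xor false true  true  = refl
exactlyOneOrAll-xor false true  false = refl
exactlyOneOrAll-xor false false true  = refl
exactlyOneOrAll-xor false false false = refl

merge : Fin (suc (suc m)) → Fin (suc m)
merge zero    = zero
merge (suc k) = k

reindex-merge : (y : Bool) (x : Vec Bool m) → reindex merge (y ∷ x) ≡ y ∷ y ∷ x
reindex-merge y x = cong (λ z → y ∷ y ∷ z) (tabulate∘lookup x)

module Minors (_≟_ : DecidableEquality V) (enum : Fin (suc (suc m)) ↔ V) (H : Hypergraph V) where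

  open Front enum
  open PairSubsets _≟_

  private
    single : V → Subset V
    single = ⁅_⁆ _≟_

    f : Ω
    f = booleanFunction enum H

  -- l_e gets position 0, the place of the variable that replaces the first two variables of
  -- `front e`.
  collapse-enum : (e : Pair V) → Fin (suc m) ↔ Maybe (Rest e)
  collapse-enum e = ↔-trans Fin↔Maybe (↔-Maybe (front-rest e))

  f/_ : Pair V → Ω
  f/ e = booleanFunction (collapse-enum e) (collapse _≟_ H e)

  module _ (e : Pair V) where

    private
      c : Coefficients (suc (suc m))
      c = coefficients (front e) H

      c/e : Coefficients (suc m)
      c/e = coefficients (collapse-enum e) (collapse _≟_ H e)

      from-front₀ : from (front e) (end₁ e) ≡ zero
      from-front₀ = inverseʳ (front e) (sym (front₀ e))

      from-front₁ : from (front e) (end₂ e) ≡ suc zero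
      from-front₁ = inverseʳ (front e) (sym (front₁ e))

      at-rest : ∀ {a b} (E : Vec Bool m) v →
        lookup (a ∷ b ∷ E) (from (front e) (proj₁ v)) ≡ lookup E (from (front-rest e) v)
      at-rest {a} {b} E v = cong (lookup (a ∷ b ∷ E)) (front-from e v)

      c-∪ : ∀ a b E (D : Subset V) → (∀ v → ¬ proj₁ v ∈ D) → a ≡ D (end₁ e) → b ≡ D (end₂ e) →
        hyperedge H (extend (∁ (proj₁ e)) (lookup E ∘ from (front-rest e)) ∪ D) ≡ c (a ∷ b ∷ E)
      c-∪ a b E D rest∉D eq₁ eq₂ = sym (hyperedge-cong H (≗-ext-∪ e D rest∉D
        (trans (cong (lookup (a ∷ b ∷ E)) from-front₀) eq₁)
        (trans (cong (lookup (a ∷ b ∷ E)) from-front₁) eq₂) (at-rest E)))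

      1∉single₂ : false ≡ single (end₂ e) (end₁ e)
      1∉single₂ = sym (T-false (end₁≢end₂ e ∘ ∈-single⁻ _≟_))

      2∉single₁ : false ≡ single (end₁ e) (end₂ e)
      2∉single₁ = sym (T-false (end₁≢end₂ e ∘ sym ∘ ∈-single⁻ _≟_))

      ∈single : ∀ v → true ≡ single v v
      ∈single v = sym (T-true (∈-single _≟_ refl))

    c/e-false : ∀ E → c/e (false ∷ E) ≡ c (false ∷ false ∷ E)
    c/e-false E = trans (hyperedge-cong H (λ v → sym (Bool.∨-identityʳ _)))
      (c-∪ false false E (λ _ → false) (λ _ ()) refl refl)

    -- Monomials containing the first variable, the second or both become equal after the
    -- identification, and their coefficients add up over GF(2). This is the parity condition
    -- defining H_e.
    c/e-true : ∀ E → c/e (true ∷ E) ≡ c (true ∷ false ∷ E) xor (c (false ∷ true ∷ E) xor c (true ∷ true ∷ E))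
    c/e-true E = trans (exactlyOneOrAll-xor _ _ _) (cong₂ _xor_
      (c-∪ true false E (single (end₁ e)) (rest∉single₁ e) (∈single _) 2∉single₁) (cong₂ _xor_
      (c-∪ false true E (single (end₂ e)) (rest∉single₂ e) 1∉single₂ (∈single _))
      (c-∪ true true E (single (end₁ e) ∪ single (end₂ e))
        (λ w → [ rest∉single₁ e w , rest∉single₂ e w ]′ ∘ ∪⁻ (single (end₁ e)) (single (end₂ e)))
        (cong₂ _∨_ (∈single (end₁ e)) refl)
        (trans (sym (Bool.∨-zeroʳ _)) (cong (single (end₁ e) (end₂ e) ∨_) (∈single (end₂ e)))))))

    ζ-collapse : ∀ y x → ζ c/e (y ∷ x) ≡ ζ c (y ∷ y ∷ x)
    ζ-collapse y x = trans
      (cong₂ (λ u v → u xor (y ∧ v)) (ζ-cong c/e-false x)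
        (trans (ζ-cong c/e-true x)
        (trans (ζ-xor (at true false) (λ E → at false true E xor at true true E) x)
               (cong (value true false xor_) (ζ-xor (at false true) (at true true) x)))))
      (diagonal y (value false false) (value true false) (value false true) (value true true))
      where
      at : Bool → Bool → Coefficients m
      at a b E = c (a ∷ b ∷ E)

      value : Bool → Bool → Bool
      value a b = ζ (at a b) x

      -- The identity rests on `y ∧ y = y`, which is no ring law; hence the case split on `y`.
      diagonal : ∀ y p q r s → p xor (y ∧ (q xor (r xor s))) ≡ (p xor (y ∧ r)) xor (y ∧ (q xor (y ∧ s)))
      diagonal false p q r s = sym (Bool.xor-identityʳ _)
      diagonal true  p q r s = solve 4 (λ p q r s → p :+ (q :+ (r :+ s)) := (p :+ r) :+ (q :+ s)) refl p q r s

    eval-collapse : ∀ y x → eval (f/ e) (y ∷ x) ≡ polynomial (front e) H (y ∷ y ∷ x)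
    eval-collapse y x = begin
      eval (f/ e) (y ∷ x)                    ≡⟨ polynomial-ζ (collapse-enum e) (collapse _≟_ H e) (y ∷ x) ⟩
      ζ c/e (y ∷ x)                          ≡⟨ ζ-collapse y x ⟩
      ζ c (y ∷ y ∷ x)                        ≡⟨ polynomial-ζ (front e) H (y ∷ y ∷ x) ⟨
      polynomial (front e) H (y ∷ y ∷ x)     ∎

    f/-≼ : f/ e ≼ f
    f/-≼ = ≼-trans {f/ e} {booleanFunction (front e) H} {f}
      (merge , λ { (y ∷ x) → trans (eval-collapse y x) (cong (polynomial (front e) H) (sym (reindex-merge y x))) })
      (≅⇒≼ (front e) enum {H} {H} (≅-refl {H = H}))

    -- A map witnessing the reverse relation would be a surjection from m + 1 variables onto m + 2.
    f/-≺ : Covered H → f/ e ≺ f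
    f/-≺ covered = f/-≼ , λ f≼f/e → contradiction
      (Fin.injective⇒≤ (section-injective {σ = proj₁ f≼f/e} (≼⇒surjective enum {H} covered {f/ e} f≼f/e))) ℕ.1+n≰n

  -- A substitution equating two variables factors through their identification. In the order of
  -- `front e` they come first, and dropping the first of them gives the factor.
  identify : ∀ {g} ((σ , _) : g ≼ f) → ∀ {a b} → a ≢ b → σ a ≡ σ b → ∃[ e ] g ≼ f/ e
  identify {g} (σ , g≗) {a} {b} a≢b σa≡σb = e , σ′ ∘ suc , λ x → begin
    eval g x                                        ≡⟨ g≗ x ⟩
    polynomial enum H (reindex σ x)                 ≡⟨ proj₂ f≼ (reindex σ x) ⟩
    polynomial (front e) H (reindex (proj₁ f≼) (reindex σ x))
      ≡⟨ cong (polynomial (front e) H) (reindex-∘ σ (proj₁ f≼) x) ⟩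
    polynomial (front e) H (reindex σ′ x)
      ≡⟨ cong (λ y → polynomial (front e) H (y ∷ reindex (σ′ ∘ suc) x)) (cong (lookup x) σ′₀≡σ′₁) ⟩
    polynomial (front e) H (lookup x (σ′ (suc zero)) ∷ reindex (σ′ ∘ suc) x)
      ≡⟨ eval-collapse e _ _ ⟨
    eval (f/ e) (reindex (σ′ ∘ suc) x)              ∎
    where
    e : Pair V
    e = pair _≟_ (a≢b ∘ to-injective enum)

    f≼ : f ≼ booleanFunction (front e) H
    f≼ = ≅⇒≼ enum (front e) {H} {H} (≅-refl {H = H})

    σ′ : Fin (suc (suc m)) → Fin (arity g)
    σ′ = σ ∘ proj₁ f≼

    σ′₀≡σ′₁ : σ′ zero ≡ σ′ (suc zero)
    σ′₀≡σ′₁ = begin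
      σ (from enum (to (front e) zero))        ≡⟨ cong (σ ∘ from enum) (front₀ e) ⟩
      σ (from enum (to enum a))                ≡⟨ cong σ (strictlyInverseʳ enum a) ⟩
      σ a                                      ≡⟨ σa≡σb ⟩
      σ b                                      ≡⟨ cong σ (strictlyInverseʳ enum b) ⟨
      σ (from enum (to enum b))                ≡⟨ cong (σ ∘ from enum) (front₁ e) ⟨
      σ (from enum (to (front e) (suc zero)))  ∎

  -- If `σ` were injective, a left inverse would show `f ≼ g`; so `σ` equates two variables.
  ≺⇒≼f/ : ∀ {g} → g ≺ f → ∃[ e ] g ≼ f/ e
  ≺⇒≼f/ {g} (h@(σ , g≗) , f⋠g)
    with Fin.any? (λ a → Fin.any? (λ b → ¬? (a Fin.≟ b) ×-dec (σ a Fin.≟ σ b)))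
  ... | yes (a , b , a≢b , σa≡σb) = identify {g} h a≢b σa≡σb
  ... | no none = contradiction (τ , f≗) f⋠g
    where
    σ-injective : ∀ {a b} → σ a ≡ σ b → a ≡ b
    σ-injective {a} {b} eq with a Fin.≟ b
    ... | yes a≡b = a≡b
    ... | no a≢b  = contradiction (a , b , a≢b , eq) none

    τ : Fin (arity g) → Fin (suc (suc m))
    τ k with Fin.any? (λ i → σ i Fin.≟ k)
    ... | yes (i , _) = i
    -- Off the range of `σ` the value is arbitrary.
    ... | no _        = zero

    τσ : ∀ i → τ (σ i) ≡ i
    τσ i with Fin.any? (λ j → σ j Fin.≟ σ i)
    ... | yes (j , eq) = σ-injective eq
    ... | no not       = contradiction (i , refl) not

    f≗ : ∀ x → eval f x ≡ eval g (reindex τ x)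
    f≗ x = sym (begin
      eval g (reindex τ x)                ≡⟨ g≗ (reindex τ x) ⟩
      eval f (reindex σ (reindex τ x))    ≡⟨ cong (eval f) (reindex-∘ τ σ x) ⟩
      eval f (reindex (τ ∘ σ) x)          ≡⟨ cong (eval f) (reindex-id τσ x) ⟩
      eval f x                            ∎)

  -- All `f/ e` are equivalent, so any one of them bounds everything below `f`; `e₀` consists of the
  -- first two vertices.
  /-≅⇒irreducible : Covered H → (∀ e e′ → collapse _≟_ H e ≅ collapse _≟_ H e′) → Irreducible f
  /-≅⇒irreducible covered iso = f/ e₀ , f/-≺ e₀ covered , λ g g≺f → below {g} (≺⇒≼f/ {g} g≺f)
    where
    0≢1 : to enum zero ≢ to enum (suc zero)
    0≢1 eq with to-injective enum eq
    ... | ()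

    e₀ : Pair V
    e₀ = pair _≟_ 0≢1

    below : ∀ {g} → ∃[ e ] g ≼ f/ e → g ≼ f/ e₀
    below {g} (e , g≼f/e) = ≼-trans {g} {f/ e} {f/ e₀} g≼f/e
      (≅⇒≼ (collapse-enum e) (collapse-enum e₀) {collapse _≟_ H e} {collapse _≟_ H e₀} (iso e e₀))

  -- The greatest function `f′` below `f` is itself below some `f/ e₀`. Every `f/ e` is below `f′`,
  -- hence below `f/ e₀`, which has the same arity, so `≼⇒≅` applies.
  irreducible⇒/-≅ : Covered H → (∀ e → Covered (collapse _≟_ H e)) → Irreducible f →
    ∀ e e′ → collapse _≟_ H e ≅ collapse _≟_ H e′
  irreducible⇒/-≅ covered covered/ (f′ , f′≺f , greatest) with ≺⇒≼f/ {f′} f′≺f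
  ... | e₀ , f′≼f/e₀ = λ e e′ → ≅-trans {H = H/ e} {H/ e₀} {H/ e′} (iso e)
                                  (≅-sym {H = H/ e′} {H/ e₀} (iso e′))
    where
    H/_ : (e : Pair V) → Hypergraph (Maybe (Rest e))
    H/_ = collapse _≟_ H

    iso : ∀ e → H/ e ≅ H/ e₀
    iso e = ≼⇒≅ (collapse-enum e) (collapse-enum e₀) {H/ e} {H/ e₀} (covered/ e)
      (≼-trans {f/ e} {f′} {f/ e₀} (greatest (f/ e) (f/-≺ e covered)) f′≼f/e₀)

-- The equivalences for Steiner systems

module _ (_≟_ : DecidableEquality V) {H : Hypergraph V}
  (line : ∀ {p q : V} → p ≢ q → ∃[ B ] (B ∈ℰ H × p ∈ B × q ∈ B)) where

  -- One of `x` and `y` differs from `v`, and the line joining it to `v` contains `v`.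
  line-covered : {x y : V} → x ≢ y → Covered H
  line-covered {x} {y} x≢y v with v ≟ x
  ... | yes refl with line x≢y
  ...   | B , B∈ℰ , v∈B , _ = B , B∈ℰ , v∈B
  line-covered {x} {y} x≢y v | no v≢x with line v≢x
  ...   | B , B∈ℰ , v∈B , _ = B , B∈ℰ , v∈B

-- The line through `e` has an image containing l_e, and the line joining `v` to an end of `e` has
-- an image containing `v`.
collapse-covered : (_≟_ : DecidableEquality V) {H : Hypergraph V} → IsLinearSpace H →
  ∀ e → Covered (collapse _≟_ H e)
collapse-covered _≟_ linear e nothing with IsLinearSpace.line linear (end₁≢end₂ e)
... | B , B∈ℰ , i∈B , _ = B /ᵉ e , LinearSpace./-∈ℰ _≟_ linear e B∈ℰ (λ _ → refl) , ⇐ Bool.T-∨ (inj₁ i∈B)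
collapse-covered _≟_ linear e (just v) with IsLinearSpace.line linear (rest≢end₁ e v)
... | B , B∈ℰ , v∈B , _ = B /ᵉ e , LinearSpace./-∈ℰ _≟_ linear e B∈ℰ (λ _ → refl) , v∈B

module _ (enum : Fin (suc (suc m)) ↔ V) (H : Hypergraph V) (steiner : IsSteinerSystem (suc (suc m)) H) where

  open IsSteinerSystem steiner using (k; 2≤k)

  private
    _≟_ : DecidableEquality V
    _≟_ = enum⇒≟ enum

    H/_ : (e : Pair V) → Hypergraph (Maybe (Rest e))
    H/_ = collapse _≟_ H

  open Minors _≟_ enum H

  steiner-equivalences :
    (Irreducible (booleanFunction enum H) ⇔ (∀ (e e′ : [ V ]^ 2) → H/ e ≅ H/ e′)) ×
    ((∀ (e e′ : [ V ]^ 2) → H/ e ≅ H/ e′) ⇔ -2-Monomorphic H)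
  steiner-equivalences = by-size (ℕ.m≤n⇒m<n∨m≡n 2≤k)
    where
    0≢1 : to enum zero ≢ to enum (suc zero)
    0≢1 eq with to-injective enum eq
    ... | ()

    covered : Covered H
    covered = line-covered _≟_ {H} (steiner-line steiner _≟_) 0≢1

    by-size : 3 ≤ k ⊎ 2 ≡ k → _
    by-size (inj₁ 3≤k) =
      mk⇔ (irreducible⇒/-≅ covered (collapse-covered _≟_ linear)) (/-≅⇒irreducible covered) ,
      mk⇔ (λ h e e′ → /-≅⇒∖-≅ e e′ (h e e′)) (λ h e e′ → ∖-≅⇒/-≅ e e′ (h e e′))
      where
      linear : IsLinearSpace H
      linear = steiner-linear steiner _≟_ 3≤k
      open LinearSpace.Finite _≟_ linear enum
    -- For complete graphs the two isomorphism statements hold outright, and irreducibility follows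
    -- from the one about H_e.
    by-size (inj₂ 2≡k) =
      mk⇔ (λ _ → symmetric-/ _≟_ enum {H} symmetric) (/-≅⇒irreducible covered) ,
      mk⇔ (λ _ → symmetric-∖ _≟_ enum {H} symmetric) (λ _ → symmetric-/ _≟_ enum {H} symmetric)
      where
      symmetric : (π : V ↔ V) → ∀ E → hyperedge H (image π E) ≡ hyperedge H E
      symmetric = graph-symmetric steiner (sym 2≡k)

theorem14 : ∀ {n : ℕ} .{{_ : NonZero n}} {V : Set} (enum : Fin n ↔ V) (H : Hypergraph V) →
    IsSteinerSystem n H →
    let H/_ = collapse (enum⇒≟ enum) H in
    (Irreducible (booleanFunction enum H) ⇔ (∀ (e e′ : [ V ]^ 2) → H/ e ≅ H/ e′)) ×
    ((∀ (e e′ : [ V ]^ 2) → H/ e ≅ H/ e′) ⇔ -2-Monomorphic H)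
theorem14 {suc (suc m)} enum H steiner = steiner-equivalences enum H steiner
-- With a single vertex, `2 ≤ k` and `k ≤ n` contradict each other.
theorem14 {suc zero} enum H steiner =
  contradiction (ℕ.≤-trans (IsSteinerSystem.2≤k steiner) (IsSteinerSystem.k≤n steiner)) ℕ.1+n≰n
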